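{- For a finite set $X$, let $\mathbf{G}[X]$ be the vector space with basis the mixed graphs with vertex set $X$, and let $\mathcal{E}[X]$ be the set of equivalence relations on $X$. For $\sim\in\mathcal{E}[X]$ define $\delta_\sim:\mathbf{G}[X]\to\mathbf{G}[X/\sim]\otimes\mathbf{G}[X]$ by $\delta_\sim(G)=G/\sim\otimes G\mid\sim$ if $\sim\in\mathcal{E}^c[G]$ and $\delta_\sim(G)=0$ otherwise, and define $\epsilon_\delta[X]:\mathbf{G}[X]\to\mathbb{K}$ by $\epsilon_\delta[X](G)=1$ if $E(G)=A(G)=\emptyset$ and $0$ otherwise. Then: (i) (coassociativity) for $\sim,\sim'\in\mathcal{E}[X]$ with $\sim$ finer than $\sim'$, denoting by $\sim'/\sim$ the equivalence induced by $\sim'$ on $X/\sim$ and identifying $(X/\sim)/(\sim'/\sim)$ with $X/\sim'$, one has $(\delta_{\sim'/\sim}\otimes\mathrm{Id})\circ\delta_\sim=(\mathrm{Id}\otimes\delta_\sim)\circ\delta_{\sim'}$ on $\mathbf{G}[X]$; (ii) (counit) for every $G\in\mathscr{G}[X]$, $\sum_{\sim\in\mathcal{E}[X]}(\epsilon_\delta[X/\sim]\otimes\mathrm{Id})\circ\delta_\sim(G)=G$, and $(\mathrm{Id}\otimes\epsilon_\delta[X])\circ\delta_\sim(G)$ equals $G$ if $\sim$ is the equality relation of $X$ and $0$ otherwise; (iii) (compatibility with the product) for disjoint finite sets $X,Y$, $G\in\mathscr{G}[X]$, $H\in\mathscr{G}[Y]$ and $\sim\in\mathcal{E}[X\sqcup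 Y]$: if $\sim$ is not of the form $\sim_X\sqcup\sim_Y$ with $\sim_X\in\mathcal{E}[X]$, $\sim_Y\in\mathcal{E}[Y]$, then $\delta_\sim(GH)=0$; if $\sim=\sim_X\sqcup\sim_Y$, then $\delta_\sim(GH)=(m_{X/\sim_X,Y/\sim_Y}\otimes m_{X,Y})\circ(\mathrm{Id}\otimes c\otimes\mathrm{Id})(\delta_{\sim_X}(G)\otimes\delta_{\sim_Y}(H))$, where $c$ is the flip of the two middle factors and $m$ is disjoint union; (iv) (compatibility with $\Delta$) for disjoint finite sets $X,Y$, $\sim_X\in\mathcal{E}[X]$, $\sim_Y\in\mathcal{E}[Y]$, $\sim=\sim_X\sqcup\sim_Y$ and $G\in\mathscr{G}[X\sqcup Y]$, $(\Delta_{X/\sim_X,Y/\sim_Y}\otimes\mathrm{Id})\circ\delta_\sim(G)=m_{1,3,24}\circ(\delta_{\sim_X}\otimes\delta_{\sim_Y})\circ\Delta_{X,Y}(G)$, where $m_{1,3,24}(a\otimes b\otimes c\otimes d)=a\otimes c\otimes m_{X,Y}(b\otimes d)$.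
   Context: A mixed graph $G$ has a finite vertex set $V(G)$, a set $E(G)$ of edges (2-element subsets) and a set $A(G)$ of arcs (ordered pairs of distinct vertices), no pair $\{x,y\}$ being both an edge and carrying an arc (both $(x,y)$ and $(y,x)$ may be arcs). $\mathscr{G}[X]$ is the set of mixed graphs with vertex set $X$. $G_{\mid I}$ is the induced mixed graph on $I\subseteq V(G)$; $I$ is an ideal of $G$ if $x\in I$ and $(x,y)\in A(G)$ imply $y\in I$. For disjoint $X,Y$, $m_{X,Y}(G\otimes H)$ is the disjoint union $GH$ and $\Delta_{X,Y}(G)=G_{\mid X}\otimes G_{\mid Y}$ if $Y$ is an ideal of $G\in\mathscr{G}[X\sqcup Y]$, $0$ otherwise. A mixed graph is connected if any two vertices are joined by a sequence of vertices in which consecutive ones are related by an edge or an arc in either direction. For $\sim\in\mathcal{E}[V(G)]$: $G\mid\sim$ has vertex set $V(G)$ and only the edges and arcs of $G$ whose extremities are $\sim$-equivalent; $G/\sim$ has vertex set $V(G)/\sim$, arcs $(\mathrm{cl}(x),\mathrm{cl}(y))$ for $(x,y)\in A(G)$ with $\mathrm{cl}(x)\neq\mathrm{cl}(y)$, and edges $\{\mathrm{cl}(x),\mathrm{cl}(y)\}$ for $\{x,y\}\in E(G)$ with $\mathrm{cl}(x)\neq\mathrm{cl}(y)$ such that there is no arc of $G/\sim$ between $\mathrm{cl}(x)$ and $\mathrm{cl}(y)$ in either direction (loops and redundant edges are deleted, arcs having priority). $\mathcal{E}^c[G]$ is the set of equivalences on $V(G)$ each of whose classes $C$ induces a connected mixed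 graph $G_{\mid C}$. -}

module Defs where

open import Level using (Level)
open import Data.Bool as Bool using (Bool; true; false; _∧_; _∨_; not; if_then_else_; T)
open import Data.Nat using (ℕ; zero; suc; _≤_; z≤n; s≤s)
open import Data.Nat.Properties using (≤-trans; m≤n⇒m≤1+n; 1+n≰n)
open import Data.List using (List; []; _∷_; _++_; map; length; deduplicate; cartesianProduct; foldr)
open import Data.List.Membership.Propositional using (_∈_; lose)
open import Data.List.Membership.Propositional.Properties using (∈-map⁺; ∈-++⁺ˡ; ∈-++⁺ʳ)
open import Data.List.Relation.Unary.Any using (Any; here; there; any?; satisfied)
open import Data.List.Relation.Unary.All as All using (All; all?)
open import Data.Maybe as Maybe using (Maybe; just; nothing)
open import Data.Product using (Σ; ∃; _×_; _,_; proj₁; proj₂)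
open import Data.Sum using (_⊎_; inj₁; inj₂)
import Data.Sum.Properties as SumP
open import Data.Empty using (⊥; ⊥-elim)
open import Data.Unit using (⊤; tt)
open import Relation.Nullary using (Dec; yes; no; ¬_)
open import Relation.Nullary.Decidable using (⌊_⌋; _×-dec_; _→-dec_; fromWitness; T?)
open import Relation.Binary using (DecidableEquality)
open import Relation.Binary.PropositionalEquality using (_≡_; refl; sym; trans; cong)
open import Algebra.Bundles using (CommutativeRing)

record FinSet : Set₁ where
  field
    Carrier  : Set
    _≟_      : DecidableEquality Carrier
    elems    : List Carrier
    complete : ∀ x → x ∈ elems
open FinSet public using (Carrier; elems; complete)

module _ (X : FinSet) where
  ∀? : {P : Carrier X → Set} → (∀ x → Dec (P x)) → Dec (∀ x → P x)
  ∀? P? with all? P? (elems X)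
  ... | yes a = yes (λ x → All.lookup a (complete X x))
  ... | no ¬a = no (λ f → ¬a (All.tabulate (λ {x} _ → f x)))

  ∃? : {P : Carrier X → Set} → (∀ x → Dec (P x)) → Dec (∃ P)
  ∃? P? with any? P? (elems X)
  ... | yes a = yes (satisfied a)
  ... | no ¬a = no (λ { (x , px) → ¬a (lose (complete X x) px) })

true? : (b : Bool) → Dec (b ≡ true)
true? b = b Bool.≟ true

false? : (b : Bool) → Dec (b ≡ false)
false? b = b Bool.≟ false

t≢f : true ≡ false → ⊥
t≢f ()

∨-inl : ∀ a {b} → a ≡ true → a ∨ b ≡ true
∨-inl true _ = refl

∨-inr : ∀ a {b} → b ≡ true → a ∨ b ≡ true
∨-inr true _ = refl
∨-inr false h = h

∨-elim : ∀ a b → a ∨ b ≡ true → a ≡ true ⊎ b ≡ true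
∨-elim true b _ = inj₁ refl
∨-elim false b h = inj₂ h

∧-split : ∀ a b → a ∧ b ≡ true → a ≡ true × b ≡ true
∧-split true true _ = refl , refl

∧-intro : ∀ {a b} → a ≡ true → b ≡ true → a ∧ b ≡ true
∧-intro refl refl = refl

bool-ext : ∀ {a b} → (a ≡ true → b ≡ true) → (b ≡ true → a ≡ true) → a ≡ b
bool-ext {true} {true} f g = refl
bool-ext {true} {false} f g = sym (f refl)
bool-ext {false} {true} f g = g refl
bool-ext {false} {false} f g = refl

T-irr : ∀ {b} (p q : T b) → p ≡ q
T-irr {true} p q = refl

-- Mixed graphs (raw data; the well-formedness conditions are IsMixedGraph)
-- arc x y = true   means (x,y) ∈ A(G)
-- edge x y = true  means {x,y} ∈ E(G)

record MGraph (X : FinSet) : Set where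
  constructor mgraph
  field
    arc  : Carrier X → Carrier X → Bool
    edge : Carrier X → Carrier X → Bool
open MGraph public

-- G ∈ 𝒢[X]: arcs join distinct vertices, edges are 2-element subsets,
-- and no pair carries both an edge and an arc.
IsMixedGraph : ∀ {X} → MGraph X → Set
IsMixedGraph G =
  (∀ x → arc G x x ≡ false) ×
  (∀ x → edge G x x ≡ false) ×
  (∀ x y → edge G x y ≡ edge G y x) ×
  (∀ x y → edge G x y ≡ true → arc G x y ≡ false)

_≅_ : ∀ {X} → MGraph X → MGraph X → Set
G ≅ H = (∀ x y → arc G x y ≡ arc H x y) × (∀ x y → edge G x y ≡ edge H x y)

_≅?_ : ∀ {X} (G H : MGraph X) → Dec (G ≅ H)
_≅?_ {X} G H =
  ∀? X (λ x → ∀? X (λ y → arc G x y Bool.≟ arc H x y)) ×-dec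
  ∀? X (λ x → ∀? X (λ y → edge G x y Bool.≟ edge H x y))

-- transport of a graph along a map of vertex sets (used with bijections
-- to realise the canonical identifications of vertex sets)
relabel : ∀ {X Y} → (Carrier Y → Carrier X) → MGraph X → MGraph Y
relabel f G = mgraph (λ a b → arc G (f a) (f b)) (λ a b → edge G (f a) (f b))

record Equiv (X : FinSet) : Set where
  field
    rel       : Carrier X → Carrier X → Bool
    rel-refl  : ∀ x → rel x x ≡ true
    rel-sym   : ∀ {x y} → rel x y ≡ true → rel y x ≡ true
    rel-trans : ∀ {x y z} → rel x y ≡ true → rel y z ≡ true → rel x z ≡ true
open Equiv public

SameRel : ∀ {X} → Equiv X → Equiv X → Set
SameRel R R' = ∀ x y → rel R x y ≡ rel R' x y

Finer : ∀ {X} → Equiv X → Equiv X → Set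
Finer R R' = ∀ x y → rel R x y ≡ true → rel R' x y ≡ true

IsEqualityRel : ∀ {X} → Equiv X → Set
IsEqualityRel R = ∀ x y → (rel R x y ≡ true → x ≡ y) × (x ≡ y → rel R x y ≡ true)

-- Quotient X/∼ : the set of canonical representatives (the first element
-- of the enumeration in each class)

module Quot (X : FinSet) (R : Equiv X) where
  private
    C = Carrier X
    _≟X_ = FinSet._≟_ X

  first : List C → C → C
  first [] x = x
  first (y ∷ ys) x = if rel R y x then y else first ys x

  rep : C → C
  rep = first (elems X)

  isRep : C → Bool
  isRep x = ⌊ rep x ≟X x ⌋

  Q : Set
  Q = Σ C (λ x → T (isRep x))

  first-rel : ∀ l x → x ∈ l → rel R (first l x) x ≡ true
  first-rel (y ∷ ys) x i with rel R y x in e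
  ... | true = e
  first-rel (y ∷ ys) x (here refl) | false = ⊥-elim (t≢f (trans (sym (rel-refl R x)) e))
  first-rel (y ∷ ys) x (there i)   | false = first-rel ys x i

  first-∈ : ∀ l x → x ∈ l → first l x ∈ l
  first-∈ (y ∷ ys) x i with rel R y x in e
  ... | true = here refl
  first-∈ (y ∷ ys) x (here refl) | false = ⊥-elim (t≢f (trans (sym (rel-refl R x)) e))
  first-∈ (y ∷ ys) x (there i)   | false = there (first-∈ ys x i)

  first-cong : ∀ l a b → a ∈ l → (∀ z → rel R z a ≡ rel R z b) → first l a ≡ first l b
  first-cong (y ∷ ys) a b i h with rel R y a in e1 | rel R y b in e2
  ... | true  | true  = refl
  ... | true  | false = ⊥-elim (t≢f (trans (sym e1) (trans (h y) e2)))
  ... | false | true  = ⊥-elim (t≢f (trans (sym e2) (trans (sym (h y)) e1)))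
  first-cong (y ∷ ys) a b (here refl) h | false | false = ⊥-elim (t≢f (trans (sym (rel-refl R a)) e1))
  first-cong (y ∷ ys) a b (there i)   h | false | false = first-cong ys a b i h

  rep-rel : ∀ x → rel R (rep x) x ≡ true
  rep-rel x = first-rel (elems X) x (complete X x)

  rep-idem : ∀ x → rep (rep x) ≡ rep x
  rep-idem x = first-cong (elems X) (rep x) x (complete X (rep x))
    (λ z → bool-ext (λ h → rel-trans R h (rep-rel x))
                    (λ h → rel-trans R h (rel-sym R (rep-rel x))))

  cl : C → Q
  cl x = rep x , fromWitness (rep-idem x)

  _≟Q_ : DecidableEquality Q
  (x , p) ≟Q (y , q) with x ≟X y
  ... | yes refl = yes (cong (x ,_) (T-irr p q))
  ... | no ne = no (λ eq → ne (cong proj₁ eq))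

  reps : List C → List Q
  reps [] = []
  reps (x ∷ xs) with T? (isRep x)
  ... | yes p = (x , p) ∷ reps xs
  ... | no _ = reps xs

  reps-complete : ∀ {x} (p : T (isRep x)) l → x ∈ l → (x , p) ∈ reps l
  reps-complete p (y ∷ ys) (here refl) with T? (isRep y)
  ... | yes p' = here (cong (y ,_) (T-irr p p'))
  ... | no ¬p = ⊥-elim (¬p p)
  reps-complete p (y ∷ ys) (there i) with T? (isRep y)
  ... | yes _ = there (reps-complete p ys i)
  ... | no _ = reps-complete p ys i

_/_ : (X : FinSet) → Equiv X → FinSet
X / R = record
  { Carrier = Quot.Q X R
  ; _≟_ = Quot._≟Q_ X R
  ; elems = Quot.reps X R (elems X)
  ; complete = λ { (x , p) → Quot.reps-complete X R p (elems X) (complete X x) }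
  }

cl : ∀ {X} (R : Equiv X) → Carrier X → Carrier (X / R)
cl {X} R = Quot.cl X R

_⧸_ : ∀ {X} (R' : Equiv X) (R : Equiv X) → Equiv (X / R)
R' ⧸ R = record
  { rel = λ a b → rel R' (proj₁ a) (proj₁ b)
  ; rel-refl = λ a → rel-refl R' (proj₁ a)
  ; rel-sym = rel-sym R'
  ; rel-trans = rel-trans R'
  }

-- G/∼ : arcs (cl x, cl y) for arcs (x,y) with cl x ≠ cl y; edges
-- {cl x, cl y} for edges {x,y} with cl x ≠ cl y and no arc between the
-- two classes in either direction.
quotG : ∀ {X} → MGraph X → (R : Equiv X) → MGraph (X / R)
quotG {X} G R = mgraph A E
  where
  _≟Q_ = FinSet._≟_ (X / R)
  ArcFrom : Carrier (X / R) → Carrier (X / R) → Set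
  ArcFrom c d = ∃ λ x → ∃ λ y → cl R x ≡ c × cl R y ≡ d × arc G x y ≡ true
  EdgeFrom : Carrier (X / R) → Carrier (X / R) → Set
  EdgeFrom c d = ∃ λ x → ∃ λ y → cl R x ≡ c × cl R y ≡ d × edge G x y ≡ true
  A : Carrier (X / R) → Carrier (X / R) → Bool
  A c d = not ⌊ c ≟Q d ⌋ ∧
          ⌊ ∃? X (λ x → ∃? X (λ y → (cl R x ≟Q c) ×-dec (cl R y ≟Q d) ×-dec true? (arc G x y))) ⌋
  E : Carrier (X / R) → Carrier (X / R) → Bool
  E c d = not ⌊ c ≟Q d ⌋ ∧
          ⌊ ∃? X (λ x → ∃? X (λ y → (cl R x ≟Q c) ×-dec (cl R y ≟Q d) ×-dec true? (edge G x y))) ⌋ ∧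
          not (A c d) ∧ not (A d c)

restrG : ∀ {X} → MGraph X → Equiv X → MGraph X
restrG G R = mgraph (λ x y → arc G x y ∧ rel R x y) (λ x y → edge G x y ∧ rel R x y)

-- x and y adjacent in the induced graph G_{∣C}, C = {z ∣ P z ≡ true}
Adjacent : ∀ {X} → MGraph X → (Carrier X → Bool) → Carrier X → Carrier X → Bool
Adjacent G P x y = P x ∧ P y ∧ (edge G x y ∨ arc G x y ∨ arc G y x)

data Walk {A : Set} (adj : A → A → Bool) : A → A → Set where
  stay : ∀ {x} → Walk adj x x
  step : ∀ {x y z} → adj x y ≡ true → Walk adj y z → Walk adj x z

ConnectedOn : ∀ {X} → MGraph X → (Carrier X → Bool) → Set
ConnectedOn G P = ∀ x y → P x ≡ true → P y ≡ true → Walk (Adjacent G P) x y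

-- ∼ ∈ ℰᶜ[G] : every class induces a connected graph
InEc : ∀ {X} → MGraph X → Equiv X → Set
InEc G R = ∀ x → ConnectedOn G (rel R x)

-- decision procedure for walks (reachability by saturation)
module Reach {C : Set} (_≟_ : DecidableEquality C) (l : List C)
             (complete : ∀ x → x ∈ l) (adj : C → C → Bool) where

  anyᵇ : (C → Bool) → List C → Bool
  anyᵇ p [] = false
  anyᵇ p (x ∷ xs) = p x ∨ anyᵇ p xs

  any-intro : ∀ {p x} xs → x ∈ xs → p x ≡ true → anyᵇ p xs ≡ true
  any-intro {p} (y ∷ ys) (here refl) px = ∨-inl (p y) px
  any-intro {p} (y ∷ ys) (there i) px = ∨-inr (p y) (any-intro ys i px)

  any-elim : ∀ {p} xs → anyᵇ p xs ≡ true → ∃ λ x → p x ≡ true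
  any-elim {p} (y ∷ ys) h with ∨-elim (p y) (anyᵇ p ys) h
  ... | inj₁ e = y , e
  ... | inj₂ e = any-elim ys e

  expand : (C → Bool) → C → Bool
  expand r w = r w ∨ anyᵇ (λ v → r v ∧ adj v w) l

  snoc : ∀ {x y z} → Walk adj x y → adj y z ≡ true → Walk adj x z
  snoc stay a = step a stay
  snoc (step a w) b = step a (snoc w b)

  count : (C → Bool) → List C → ℕ
  count r [] = 0
  count r (x ∷ xs) = if r x then suc (count r xs) else count r xs

  count-≤ : ∀ r xs → count r xs ≤ length xs
  count-≤ r [] = z≤n
  count-≤ r (x ∷ xs) with r x
  ... | true = s≤s (count-≤ r xs)
  ... | false = m≤n⇒m≤1+n (count-≤ r xs)

  Sub : (C → Bool) → (C → Bool) → Set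
  Sub r s = ∀ w → r w ≡ true → s w ≡ true

  count-mono : ∀ {r s} → Sub r s → ∀ xs → count r xs ≤ count s xs
  count-mono sub [] = z≤n
  count-mono {r} {s} sub (x ∷ xs) with r x in eq
  ... | true rewrite sub x eq = s≤s (count-mono sub xs)
  ... | false with s x
  ...   | true = m≤n⇒m≤1+n (count-mono sub xs)
  ...   | false = count-mono sub xs

  count-strict : ∀ {r s} → Sub r s → ∀ {w} xs → w ∈ xs → r w ≡ false → s w ≡ true →
                 suc (count r xs) ≤ count s xs
  count-strict {r} {s} sub (x ∷ xs) (here refl) rw sw rewrite rw | sw = s≤s (count-mono sub xs)
  count-strict {r} {s} sub (x ∷ xs) (there i) rw sw with r x in eq
  ... | true rewrite sub x eq = s≤s (count-strict sub xs i rw sw)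
  ... | false with s x
  ...   | true = m≤n⇒m≤1+n (count-strict sub xs i rw sw)
  ...   | false = count-strict sub xs i rw sw

  count-pos : ∀ {r w} xs → w ∈ xs → r w ≡ true → 1 ≤ count r xs
  count-pos {r} (x ∷ xs) (here refl) rw rewrite rw = s≤s z≤n
  count-pos {r} (x ∷ xs) (there i) rw with r x
  ... | true = s≤s z≤n
  ... | false = count-pos xs i rw

  Stable : (C → Bool) → Set
  Stable r = Sub (expand r) r

  expand-sub : ∀ r → Sub r (expand r)
  expand-sub r w h = ∨-inl (r w) h

  stable-step : ∀ r → Stable r → Stable (expand r)
  stable-step r st w h with ∨-elim (expand r w) _ h
  ... | inj₁ e = e
  ... | inj₂ e with any-elim l e
  ...   | v , hv with ∧-split (expand r v) (adj v w) hv
  ...     | a , b = ∨-inr (r w) (any-intro {p = λ u → r u ∧ adj u w} l (complete v) (∧-intro (st v a) b))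

  search : ∀ r xs → (∀ {w} → w ∈ xs → expand r w ≡ true → r w ≡ true) ⊎
                     (∃ λ w → expand r w ≡ true × r w ≡ false)
  search r [] = inj₁ (λ ())
  search r (x ∷ xs) with search r xs
  ... | inj₂ e = inj₂ e
  ... | inj₁ f with r x in e1
  ...   | true = inj₁ λ { (here refl) _ → e1 ; (there i) h → f i h }
  ...   | false with expand r x in e2
  ...     | true = inj₂ (x , e2 , e1)
  ...     | false = inj₁ λ { (here refl) h → ⊥-elim (t≢f (trans (sym h) e2)) ; (there i) h → f i h }

  module From (y : C) where
    r0 : C → Bool
    r0 w = ⌊ y ≟ w ⌋

    iter : ℕ → C → Bool
    iter zero = r0
    iter (suc k) = expand (iter k)

    sound : ∀ k w → iter k w ≡ true → Walk adj y w
    sound zero w h with y ≟ w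
    sound zero w h  | yes refl = stay
    sound zero w () | no _
    sound (suc k) w h with ∨-elim (iter k w) _ h
    ... | inj₁ e = sound k w e
    ... | inj₂ e with any-elim l e
    ...   | v , hv with ∧-split (iter k v) (adj v w) hv
    ...     | a , b = snoc (sound k v a) b

    r0y : r0 y ≡ true
    r0y with y ≟ y
    ... | yes _ = refl
    ... | no ne = ⊥-elim (ne refl)

    iter-y : ∀ k → iter k y ≡ true
    iter-y zero = r0y
    iter-y (suc k) = expand-sub (iter k) y (iter-y k)

    bound : ∀ k → Stable (iter k) ⊎ (suc k ≤ count (iter k) l)
    bound zero = inj₂ (count-pos l (complete y) r0y)
    bound (suc k) with bound k
    ... | inj₁ st = inj₁ (stable-step (iter k) st)
    ... | inj₂ b with search (iter k) l
    ...   | inj₁ f = inj₁ (stable-step (iter k) (λ w → f (complete w)))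
    ...   | inj₂ (w , e , n) =
            inj₂ (≤-trans (s≤s b) (count-strict (expand-sub (iter k)) l (complete w) n e))

    stableN : Stable (iter (length l))
    stableN with bound (length l)
    ... | inj₁ s = s
    ... | inj₂ b = ⊥-elim (1+n≰n (≤-trans b (count-≤ (iter (length l)) l)))

    closed : ∀ {a w} → iter (length l) a ≡ true → Walk adj a w → iter (length l) w ≡ true
    closed ha stay = ha
    closed {a} ha (step {y = v} e w) =
      closed (stableN v (∨-inr (iter (length l) v)
               (any-intro {p = λ u → iter (length l) u ∧ adj u v} l (complete a) (∧-intro ha e)))) w

    decWalk : ∀ w → Dec (Walk adj y w)
    decWalk w with iter (length l) w in e
    ... | true = yes (sound (length l) w e)
    ... | false = no (λ wk → t≢f (trans (sym (closed (iter-y (length l)) wk)) e))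

Walk? : ∀ {X} (adj : Carrier X → Carrier X → Bool) x y → Dec (Walk adj x y)
Walk? {X} adj x y = Reach.From.decWalk (FinSet._≟_ X) (elems X) (complete X) adj x y

ConnectedOn? : ∀ {X} (G : MGraph X) P → Dec (ConnectedOn G P)
ConnectedOn? {X} G P =
  ∀? X (λ x → ∀? X (λ y → true? (P x) →-dec (true? (P y) →-dec Walk? {X} (Adjacent G P) x y)))

InEc? : ∀ {X} (G : MGraph X) R → Dec (InEc G R)
InEc? {X} G R = ∀? X (λ x → ConnectedOn? G (rel R x))

-- The maps δ_∼ and ε_δ, on basis elements.
-- An element of a tensor product of graph spaces that is either 0 or a
-- single basis tensor is represented by Maybe (nothing = 0).

δ : ∀ {X} (R : Equiv X) → MGraph X → Maybe (MGraph (X / R) × MGraph X)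
δ R G with InEc? G R
... | yes _ = just (quotG G R , restrG G R)
... | no _ = nothing

NoEdgeNoArc : ∀ {X} → MGraph X → Set
NoEdgeNoArc {X} G = ∀ x y → arc G x y ≡ false × edge G x y ≡ false

NoEdgeNoArc? : ∀ {X} (G : MGraph X) → Dec (NoEdgeNoArc G)
NoEdgeNoArc? {X} G = ∀? X (λ x → ∀? X (λ y → false? (arc G x y) ×-dec false? (edge G x y)))

-- ε_δ[X](G) ∈ {1, 0}, as a Bool
εδ : ∀ {X} → MGraph X → Bool
εδ G = ⌊ NoEdgeNoArc? G ⌋

_⊗Id : ∀ {A A₁ A₂ B : Set} → (A → Maybe (A₁ × A₂)) → Maybe (A × B) → Maybe (A₁ × A₂ × B)
(f ⊗Id) nothing = nothing
(f ⊗Id) (just (a , b)) = Maybe.map (λ { (a₁ , a₂) → a₁ , a₂ , b }) (f a)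

Id⊗_ : ∀ {A B B₁ B₂ : Set} → (B → Maybe (B₁ × B₂)) → Maybe (A × B) → Maybe (A × B₁ × B₂)
(Id⊗ f) nothing = nothing
(Id⊗ f) (just (a , b)) = Maybe.map (λ { (b₁ , b₂) → a , b₁ , b₂ }) (f b)

εδ⊗Id∘δ : ∀ {X} (R : Equiv X) → MGraph X → Maybe (MGraph X)
εδ⊗Id∘δ R G with δ R G
... | nothing = nothing
... | just (A , B) = if εδ A then just B else nothing

Id⊗εδ∘δ : ∀ {X} (R : Equiv X) → MGraph X → Maybe (MGraph (X / R))
Id⊗εδ∘δ R G with δ R G
... | nothing = nothing
... | just (A , B) = if εδ B then just A else nothing

data MaybeRel {A : Set} (_~_ : A → A → Set) : Maybe A → Maybe A → Set where
  nothing : MaybeRel _~_ nothing nothing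
  just    : ∀ {a b} → a ~ b → MaybeRel _~_ (just a) (just b)

_≈₁_ : ∀ {X} → Maybe (MGraph X) → Maybe (MGraph X) → Set
_≈₁_ = MaybeRel _≅_

_≈₂_ : ∀ {X Y} → Maybe (MGraph X × MGraph Y) → Maybe (MGraph X × MGraph Y) → Set
_≈₂_ = MaybeRel (λ p q → proj₁ p ≅ proj₁ q × proj₂ p ≅ proj₂ q)

_≈₃_ : ∀ {X Y Z} → Maybe (MGraph X × MGraph Y × MGraph Z) →
       Maybe (MGraph X × MGraph Y × MGraph Z) → Set
_≈₃_ = MaybeRel (λ p q → proj₁ p ≅ proj₁ q × proj₁ (proj₂ p) ≅ proj₁ (proj₂ q) ×
                          proj₂ (proj₂ p) ≅ proj₂ (proj₂ q))

-- The canonical identification (X/∼)/(∼'/∼) ≅ X/∼' (as a map X/∼' → (X/∼)/(∼'/∼))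

φ : ∀ {X} (R R' : Equiv X) → Carrier (X / R') → Carrier ((X / R) / (R' ⧸ R))
φ R R' c = cl (R' ⧸ R) (cl R (proj₁ c))

_⊎ˢ_ : FinSet → FinSet → FinSet
X ⊎ˢ Y = record
  { Carrier = Carrier X ⊎ Carrier Y
  ; _≟_ = SumP.≡-dec (FinSet._≟_ X) (FinSet._≟_ Y)
  ; elems = map inj₁ (elems X) ++ map inj₂ (elems Y)
  ; complete = λ { (inj₁ x) → ∈-++⁺ˡ (∈-map⁺ inj₁ (complete X x))
                 ; (inj₂ y) → ∈-++⁺ʳ (map inj₁ (elems X)) (∈-map⁺ inj₂ (complete Y y)) }
  }

_·_ : ∀ {X Y} → MGraph X → MGraph Y → MGraph (X ⊎ˢ Y)
G · H = mgraph a e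
  where
  a : _ → _ → Bool
  a (inj₁ x) (inj₁ x') = arc G x x'
  a (inj₂ y) (inj₂ y') = arc H y y'
  a _ _ = false
  e : _ → _ → Bool
  e (inj₁ x) (inj₁ x') = edge G x x'
  e (inj₂ y) (inj₂ y') = edge H y y'
  e _ _ = false

_⊕_ : ∀ {X Y} → Equiv X → Equiv Y → Equiv (X ⊎ˢ Y)
_⊕_ {X} {Y} RX RY = record { rel = r ; rel-refl = rf ; rel-sym = λ {u} {v} → sy {u} {v} ; rel-trans = λ {u} {v} {w} → tr {u} {v} {w} }
  where
  r : Carrier X ⊎ Carrier Y → Carrier X ⊎ Carrier Y → Bool
  r (inj₁ x) (inj₁ x') = rel RX x x'
  r (inj₂ y) (inj₂ y') = rel RY y y'
  r _ _ = false
  rf : ∀ u → r u u ≡ true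
  rf (inj₁ x) = rel-refl RX x
  rf (inj₂ y) = rel-refl RY y
  sy : ∀ {u v} → r u v ≡ true → r v u ≡ true
  sy {inj₁ _} {inj₁ _} h = rel-sym RX h
  sy {inj₂ _} {inj₂ _} h = rel-sym RY h
  tr : ∀ {u v w} → r u v ≡ true → r v w ≡ true → r u w ≡ true
  tr {inj₁ _} {inj₁ _} {inj₁ _} h h' = rel-trans RX h h'
  tr {inj₂ _} {inj₂ _} {inj₂ _} h h' = rel-trans RY h h'

-- the canonical identification X/∼_X ⊔ Y/∼_Y ≅ (X ⊔ Y)/(∼_X ⊔ ∼_Y)
ψ : ∀ {X Y} (RX : Equiv X) (RY : Equiv Y) →
    Carrier ((X / RX) ⊎ˢ (Y / RY)) → Carrier ((X ⊎ˢ Y) / (RX ⊕ RY))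
ψ RX RY (inj₁ a) = cl (RX ⊕ RY) (inj₁ (proj₁ a))
ψ RX RY (inj₂ b) = cl (RX ⊕ RY) (inj₂ (proj₁ b))

isInj₂ : ∀ {A B : Set} → A ⊎ B → Bool
isInj₂ (inj₁ _) = false
isInj₂ (inj₂ _) = true

IsIdealʳ : ∀ {X Y} → MGraph (X ⊎ˢ Y) → Set
IsIdealʳ G = ∀ u v → isInj₂ u ≡ true → arc G u v ≡ true → isInj₂ v ≡ true

IsIdealʳ? : ∀ {X Y} (G : MGraph (X ⊎ˢ Y)) → Dec (IsIdealʳ G)
IsIdealʳ? {X} {Y} G = ∀? (X ⊎ˢ Y) (λ u → ∀? (X ⊎ˢ Y) (λ v →
  true? (isInj₂ u) →-dec (true? (arc G u v) →-dec true? (isInj₂ v))))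

Δ : ∀ {X Y} → MGraph (X ⊎ˢ Y) → Maybe (MGraph X × MGraph Y)
Δ G with IsIdealʳ? G
... | yes _ = just (relabel inj₁ G , relabel inj₂ G)
... | no _ = nothing

m⊗m∘c : ∀ {X X' Y Y'} → Maybe (MGraph X' × MGraph X) → Maybe (MGraph Y' × MGraph Y) →
        Maybe (MGraph (X' ⊎ˢ Y') × MGraph (X ⊎ˢ Y))
m⊗m∘c (just (a , b)) (just (c , d)) = just (a · c , b · d)
m⊗m∘c _ _ = nothing

δ⊗δ : ∀ {X Y} (RX : Equiv X) (RY : Equiv Y) → Maybe (MGraph X × MGraph Y) →
      Maybe ((MGraph (X / RX) × MGraph X) × (MGraph (Y / RY) × MGraph Y))
δ⊗δ RX RY nothing = nothing
δ⊗δ RX RY (just (G , H)) with δ RX G | δ RY H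
... | just p | just q = just (p , q)
... | _ | _ = nothing

m₁₃₂₄ : ∀ {X X' Y Y'} → Maybe ((MGraph X' × MGraph X) × (MGraph Y' × MGraph Y)) →
        Maybe (MGraph X' × MGraph Y' × MGraph (X ⊎ˢ Y))
m₁₃₂₄ nothing = nothing
m₁₃₂₄ (just ((a , b) , (c , d))) = just (a , c , b · d)

-- ℰ[X] as a list (each equivalence relation exactly once up to SameRel)

sublists : ∀ {A : Set} → List A → List (List A)
sublists [] = [] ∷ []
sublists (x ∷ xs) = sublists xs ++ map (x ∷_) (sublists xs)

module _ (X : FinSet) where
  private
    C = Carrier X
    _≟X_ = FinSet._≟_ X

  relOf : List (C × C) → C → C → Bool
  relOf [] x y = false
  relOf ((a , b) ∷ S) x y = (⌊ a ≟X x ⌋ ∧ ⌊ b ≟X y ⌋) ∨ relOf S x y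

  toEquiv : (C → C → Bool) → Maybe (Equiv X)
  toEquiv r with ∀? X (λ x → true? (r x x))
               | ∀? X (λ x → ∀? X (λ y → true? (r x y) →-dec true? (r y x)))
               | ∀? X (λ x → ∀? X (λ y → ∀? X (λ z →
                   true? (r x y) →-dec (true? (r y z) →-dec true? (r x z)))))
  ... | yes rf | yes sy | yes tr = just (record
        { rel = r ; rel-refl = rf ; rel-sym = λ {x} {y} → sy x y
        ; rel-trans = λ {x} {y} {z} → tr x y z })
  ... | _ | _ | _ = nothing

  SameRel? : (R R' : Equiv X) → Dec (SameRel R R')
  SameRel? R R' = ∀? X (λ x → ∀? X (λ y → rel R x y Bool.≟ rel R' x y))

  Equivs : List (Equiv X)
  Equivs = deduplicate SameRel?
             (Data.List.mapMaybe toEquiv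
               (map relOf (sublists (cartesianProduct (elems X) (elems X)))))

-- Linear combinations over a commutative ring K: coefficient of the basis
-- element H in a (0 or basis) vector, and finite sums.

module Coeff {c ℓ : Level} (K : CommutativeRing c ℓ) where
  open CommutativeRing K using (_+_; 0#; 1#) renaming (Carrier to ∣K∣)

  coeff : ∀ {X} → Maybe (MGraph X) → MGraph X → ∣K∣
  coeff nothing H = 0#
  coeff (just A) H = if ⌊ A ≅? H ⌋ then 1# else 0#

  ∑ : ∀ {A : Set} → List A → (A → ∣K∣) → ∣K∣
  ∑ xs f = foldr (λ a s → f a + s) 0# xs

-- Every graph occurring in these identities (quotients G/∼, restrictions G∣∼, disjoint unions,
-- relabellings along injections) is determined by two relations: which pairs of vertices carry an
-- arc, and which carry an edge before the rule "arcs have priority" is applied. So each identity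
-- between graphs reduces to matching these relations, class by class. The side condition
-- ∼ ∈ ℰᶜ[G] holds on one side iff it holds on the other, by lifting walks of a quotient back to G
-- through the connected classes, and projecting walks of G down. In the counit sum the only nonzero
-- term is the relation "same connected component", which occurs exactly once in ℰ[X].

module Submission where

open import Defs
open import Level using (Level)
open import Algebra.Bundles using (CommutativeRing)
open import Data.Bool using (Bool; true; false; _∧_; not; if_then_else_; T)
open import Data.Bool.Properties using (∧-identityʳ; ∧-zeroʳ; ∧-comm; ∧-assoc; ¬-not)
import Data.Bool as Bool
open import Data.Empty using (⊥; ⊥-elim)
open import Data.List using ([]; _∷_; cartesianProduct; filter)
import Data.List as List
open import Data.List.Membership.Propositional using (_∈_)
open import Data.List.Membership.Propositional.Properties
  using (∈-map⁺; ∈-++⁺ˡ; ∈-++⁺ʳ; ∈-cartesianProduct⁺; ∈-filter⁺; ∈-filter⁻)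
open import Data.List.Relation.Unary.All as All using (All; []; _∷_)
open import Data.List.Relation.Unary.All.Properties using (All¬⇒¬Any)
open import Data.List.Relation.Unary.AllPairs as AllPairs using (AllPairs; []; _∷_)
open import Data.List.Relation.Unary.Any as Any using (Any; here; there)
import Data.List.Relation.Unary.Any.Properties as Anyₚ
import Data.List.Relation.Unary.Unique.DecSetoid.Properties as Uniqueₚ
open import Data.Maybe using (Maybe; just; nothing; map)
import Data.Maybe.Relation.Unary.Any as Maybeᴬ
open import Data.Product using (∃; _×_; _,_; proj₁; proj₂)
open import Data.Sum using (_⊎_; inj₁; inj₂)
open import Data.Sum.Properties using (inj₁-injective; inj₂-injective)
open import Function.Bundles using (_⇔_; mk⇔; Equivalence)
open import Relation.Binary.Bundles using (DecSetoid)
open import Relation.Binary.PropositionalEquality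
  using (_≡_; _≢_; ≢-sym; refl; sym; trans; cong; subst; subst₂; module ≡-Reasoning)
open import Relation.Nullary using (Dec; yes; no; ¬_; does)
open import Relation.Nullary.Decidable using (⌊_⌋; toWitness; _×-dec_; _→-dec_; ¬?)

open Equivalence using (to; from)

⌊⌋-true⁻ : ∀ {P : Set} (d : Dec P) → ⌊ d ⌋ ≡ true → P
⌊⌋-true⁻ (yes p) _ = p

⌊⌋-true⁺ : ∀ {P : Set} (d : Dec P) → P → ⌊ d ⌋ ≡ true
⌊⌋-true⁺ (yes _) _ = refl
⌊⌋-true⁺ (no ¬p) p = ⊥-elim (¬p p)

⌊⌋-false⁻ : ∀ {P : Set} (d : Dec P) → ⌊ d ⌋ ≡ false → ¬ P
⌊⌋-false⁻ (no ¬p) _ = ¬p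

⌊⌋-false⁺ : ∀ {P : Set} (d : Dec P) → ¬ P → ⌊ d ⌋ ≡ false
⌊⌋-false⁺ (yes p) ¬p = ⊥-elim (¬p p)
⌊⌋-false⁺ (no _) _ = refl

⌊⌋-⇔ : ∀ {P Q : Set} (d : Dec P) (e : Dec Q) → P ⇔ Q → ⌊ d ⌋ ≡ ⌊ e ⌋
⌊⌋-⇔ d e P⇔Q = bool-ext (λ h → ⌊⌋-true⁺ e (to P⇔Q (⌊⌋-true⁻ d h)))
                        (λ h → ⌊⌋-true⁺ d (from P⇔Q (⌊⌋-true⁻ e h)))

not-true⁻ : ∀ {b} → not b ≡ true → b ≡ false
not-true⁻ {false} _ = refl

not-true⁺ : ∀ {b} → b ≡ false → not b ≡ true
not-true⁺ refl = refl

false⇒¬true : ∀ {b} → b ≡ false → ¬ (b ≡ true)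
false⇒¬true refl ()

∧-elimˡ : ∀ a {b} → a ∧ b ≡ true → a ≡ true
∧-elimˡ a h = proj₁ (∧-split a _ h)

∧-elimʳ : ∀ a {b} → a ∧ b ≡ true → b ≡ true
∧-elimʳ a h = proj₂ (∧-split a _ h)

∧-implied : ∀ a {b} → (a ≡ true → b ≡ true) → a ∧ b ≡ a
∧-implied true h = h refl
∧-implied false h = refl

walk-map : ∀ {A : Set} {adj adj′ : A → A → Bool} → (∀ x y → adj x y ≡ true → adj′ x y ≡ true) →
           ∀ {x y} → Walk adj x y → Walk adj′ x y
walk-map h stay = stay
walk-map h (step a w) = step (h _ _ a) (walk-map h w)

walk-gmap : ∀ {A B : Set} {adj : A → A → Bool} {adj′ : B → B → Bool} (f : A → B) →
            (∀ x y → adj x y ≡ true → adj′ (f x) (f y) ≡ true) →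
            ∀ {x y} → Walk adj x y → Walk adj′ (f x) (f y)
walk-gmap f h stay = stay
walk-gmap f h (step a w) = step (h _ _ a) (walk-gmap f h w)

walk-++ : ∀ {A : Set} {adj : A → A → Bool} {x y z} → Walk adj x y → Walk adj y z → Walk adj x z
walk-++ stay w = w
walk-++ (step a v) w = step a (walk-++ v w)

walk-snoc : ∀ {A : Set} {adj : A → A → Bool} {x y z} → Walk adj x y → adj y z ≡ true → Walk adj x z
walk-snoc w a = walk-++ w (step a stay)

walk-reverse : ∀ {A : Set} {adj : A → A → Bool} → (∀ x y → adj x y ≡ true → adj y x ≡ true) →
               ∀ {x y} → Walk adj x y → Walk adj y x
walk-reverse s stay = stay
walk-reverse s (step a w) = walk-snoc (walk-reverse s w) (s _ _ a)

module _ {X : FinSet} (R : Equiv X) where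
  open Quot X R using (rep; rep-rel; isRep; first-cong)

  private
    class-≡ : ∀ {a b} → a ≡ b → (p : T (isRep a)) (q : T (isRep b)) →
              _≡_ {A = Carrier (X / R)} (a , p) (b , q)
    class-≡ {a} refl p q = cong (a ,_) (T-irr p q)

  cl-proj : (c : Carrier (X / R)) → cl R (proj₁ c) ≡ c
  cl-proj (x , p) = class-≡ (toWitness p) _ p

  rel-rep : ∀ x → rel R x (rep x) ≡ true
  rel-rep x = rel-sym R (rep-rel x)

  rel⇒cl≡ : ∀ {x y} → rel R x y ≡ true → cl R x ≡ cl R y
  rel⇒cl≡ {x} {y} h = class-≡ (first-cong (elems X) x y (complete X x)
    (λ z → bool-ext (λ h′ → rel-trans R h′ h) (λ h′ → rel-trans R h′ (rel-sym R h)))) _ _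

  cl≡⇒rel : ∀ {x y} → cl R x ≡ cl R y → rel R x y ≡ true
  cl≡⇒rel {x} {y} e = rel-trans R (rel-rep x) (subst (λ z → rel R z y ≡ true) (sym (cong proj₁ e)) (rep-rel y))

  cl≡⇒rel-proj : ∀ {x c} → cl R x ≡ c → rel R x (proj₁ c) ≡ true
  cl≡⇒rel-proj {x} {c} e = cl≡⇒rel (trans e (sym (cl-proj c)))

  rel-proj⇒cl≡ : ∀ {x c} → rel R x (proj₁ c) ≡ true → cl R x ≡ c
  rel-proj⇒cl≡ {x} {c} h = trans (rel⇒cl≡ h) (cl-proj c)

-- Graphs presented by arcs and edges

-- The shape of the definition of G/∼, with α and ε the arcs and edges lying over a pair of classes.
record Generated {Z : FinSet} (Q : MGraph Z) (α ε : Carrier Z → Carrier Z → Set) : Set where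
  field
    arc⁻  : ∀ z w → arc Q z w ≡ true → z ≢ w × α z w
    arc⁺  : ∀ z w → z ≢ w → α z w → arc Q z w ≡ true
    edge⁻ : ∀ z w → edge Q z w ≡ true → z ≢ w × ε z w × ¬ α z w × ¬ α w z
    edge⁺ : ∀ z w → z ≢ w → ε z w → ¬ α z w → ¬ α w z → edge Q z w ≡ true
open Generated

generated-≅ : ∀ {Z} {Q Q′ : MGraph Z} {α ε α′ ε′} → Generated Q α ε → Generated Q′ α′ ε′ →
              (∀ z w → z ≢ w → α z w ⇔ α′ z w) →
              (∀ z w → z ≢ w → ¬ α z w → ¬ α w z → ε z w ⇔ ε′ z w) → Q ≅ Q′
generated-≅ {Q = Q} {Q′} {α} {ε} {α′} {ε′} q q′ α⇔ ε⇔ = arcs , edges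
  where
  arcs : ∀ z w → arc Q z w ≡ arc Q′ z w
  arcs z w = bool-ext
    (λ h → let (ne , a) = arc⁻ q z w h in arc⁺ q′ z w ne (to (α⇔ z w ne) a))
    (λ h → let (ne , a) = arc⁻ q′ z w h in arc⁺ q z w ne (from (α⇔ z w ne) a))

  ¬α′ : ∀ z w → z ≢ w → ¬ α z w → ¬ α′ z w
  ¬α′ z w ne n a = n (from (α⇔ z w ne) a)

  ¬α : ∀ z w → z ≢ w → ¬ α′ z w → ¬ α z w
  ¬α z w ne n a = n (to (α⇔ z w ne) a)

  edges : ∀ z w → edge Q z w ≡ edge Q′ z w
  edges z w = bool-ext
    (λ h → let (ne , e , n₁ , n₂) = edge⁻ q z w h in
      edge⁺ q′ z w ne (to (ε⇔ z w ne n₁ n₂) e) (¬α′ z w ne n₁) (¬α′ w z (≢-sym ne) n₂))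
    (λ h → let (ne , e , n₁ , n₂) = edge⁻ q′ z w h
               m₁ = ¬α z w ne n₁ ; m₂ = ¬α w z (≢-sym ne) n₂ in
      edge⁺ q z w ne (from (ε⇔ z w ne m₁ m₂) e) m₁ m₂)

Image² : ∀ {A B : Set} → (A → B) → (A → A → Bool) → B → B → Set
Image² f r c d = ∃ λ x → ∃ λ y → f x ≡ c × f y ≡ d × r x y ≡ true

quotG-generated : ∀ {X} (G : MGraph X) (R : Equiv X) →
                  Generated (quotG G R) (Image² (cl R) (arc G)) (Image² (cl R) (edge G))
quotG-generated {X} G R = record { arc⁻ = arc⁻′ ; arc⁺ = arc⁺′ ; edge⁻ = edge⁻′ ; edge⁺ = edge⁺′ }
  where
  _≟Q_ = FinSet._≟_ (X / R)

  image? : ∀ r c d → Dec (Image² (cl R) r c d)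
  image? r c d = ∃? X (λ x → ∃? X (λ y → (cl R x ≟Q c) ×-dec (cl R y ≟Q d) ×-dec true? (r x y)))

  arc⁻′ : ∀ c d → arc (quotG G R) c d ≡ true → c ≢ d × Image² (cl R) (arc G) c d
  arc⁻′ c d h = let (h₁ , h₂) = ∧-split (not ⌊ c ≟Q d ⌋) _ h in
    ⌊⌋-false⁻ (c ≟Q d) (not-true⁻ h₁) , ⌊⌋-true⁻ (image? (arc G) c d) h₂

  arc⁺′ : ∀ c d → c ≢ d → Image² (cl R) (arc G) c d → arc (quotG G R) c d ≡ true
  arc⁺′ c d ne a = ∧-intro (not-true⁺ (⌊⌋-false⁺ (c ≟Q d) ne)) (⌊⌋-true⁺ (image? (arc G) c d) a)

  no-arc : ∀ c d → ¬ Image² (cl R) (arc G) c d → arc (quotG G R) c d ≡ false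
  no-arc c d n = ¬-not (λ h → n (proj₂ (arc⁻′ c d h)))

  edge⁻′ : ∀ c d → edge (quotG G R) c d ≡ true →
           c ≢ d × Image² (cl R) (edge G) c d × ¬ Image² (cl R) (arc G) c d × ¬ Image² (cl R) (arc G) d c
  edge⁻′ c d h =
    let (h₁ , h₂) = ∧-split (not ⌊ c ≟Q d ⌋) _ h
        (h₃ , h₄) = ∧-split ⌊ image? (edge G) c d ⌋ _ h₂
        (h₅ , h₆) = ∧-split (not (arc (quotG G R) c d)) _ h₄
        ne = ⌊⌋-false⁻ (c ≟Q d) (not-true⁻ h₁) in
    ne , ⌊⌋-true⁻ (image? (edge G) c d) h₃ ,
    (λ a → false⇒¬true (not-true⁻ h₅) (arc⁺′ c d ne a)) ,
    (λ a → false⇒¬true (not-true⁻ h₆) (arc⁺′ d c (≢-sym ne) a))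

  edge⁺′ : ∀ c d → c ≢ d → Image² (cl R) (edge G) c d →
           ¬ Image² (cl R) (arc G) c d → ¬ Image² (cl R) (arc G) d c → edge (quotG G R) c d ≡ true
  edge⁺′ c d ne e n₁ n₂ =
    ∧-intro (not-true⁺ (⌊⌋-false⁺ (c ≟Q d) ne)) (∧-intro (⌊⌋-true⁺ (image? (edge G) c d) e)
      (∧-intro (not-true⁺ (no-arc c d n₁)) (not-true⁺ (no-arc d c n₂))))

relabel-generated : ∀ {Z Z′} {Q : MGraph Z} {α ε} (f : Carrier Z′ → Carrier Z) →
                    (∀ {a b} → f a ≡ f b → a ≡ b) → Generated Q α ε →
                    Generated {Z′} (relabel f Q) (λ a b → α (f a) (f b)) (λ a b → ε (f a) (f b))
relabel-generated f f-inj q = record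
  { arc⁻  = λ z w h → let (ne , a) = arc⁻ q _ _ h in (λ e → ne (cong f e)) , a
  ; arc⁺  = λ z w ne a → arc⁺ q _ _ (λ e → ne (f-inj e)) a
  ; edge⁻ = λ z w h → let (ne , e , n₁ , n₂) = edge⁻ q _ _ h in (λ e → ne (cong f e)) , e , n₁ , n₂
  ; edge⁺ = λ z w ne e n₁ n₂ → edge⁺ q _ _ (λ e → ne (f-inj e)) e n₁ n₂ }

restrG-generated : ∀ {Z} {Q : MGraph Z} {α ε} (S : Equiv Z) → Generated Q α ε →
                   Generated (restrG Q S) (λ a b → α a b × rel S a b ≡ true) (λ a b → ε a b × rel S a b ≡ true)
restrG-generated S q = record
  { arc⁻  = λ z w h → let (h₁ , h₂) = ∧-split _ _ h ; (ne , a) = arc⁻ q _ _ h₁ in ne , a , h₂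
  ; arc⁺  = λ z w ne (a , s) → ∧-intro (arc⁺ q _ _ ne a) s
  ; edge⁻ = λ z w h → let (h₁ , h₂) = ∧-split _ _ h ; (ne , e , n₁ , n₂) = edge⁻ q _ _ h₁ in
                      ne , (e , h₂) , (λ a → n₁ (proj₁ a)) , (λ a → n₂ (proj₁ a))
  ; edge⁺ = λ z w ne (e , s) n₁ n₂ →
      ∧-intro (edge⁺ q _ _ ne e (λ a → n₁ (a , s)) (λ a → n₂ (a , rel-sym S s))) s }

_⊕ᴿ_ : ∀ {A B : Set} → (A → A → Set) → (B → B → Set) → A ⊎ B → A ⊎ B → Set
(α ⊕ᴿ β) (inj₁ x) (inj₁ x′) = α x x′
(α ⊕ᴿ β) (inj₂ y) (inj₂ y′) = β y y′
(α ⊕ᴿ β) _ _ = ⊥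

·-generated : ∀ {X Y} {G : MGraph X} {H : MGraph Y} {αG εG αH εH} →
              Generated G αG εG → Generated H αH εH → Generated (G · H) (αG ⊕ᴿ αH) (εG ⊕ᴿ εH)
·-generated {X} {Y} {G} {H} {αG} {εG} {αH} {εH} g h =
  record { arc⁻ = arc⁻′ ; arc⁺ = arc⁺′ ; edge⁻ = edge⁻′ ; edge⁺ = edge⁺′ }
  where
  arc⁻′ : ∀ z w → arc (G · H) z w ≡ true → z ≢ w × (αG ⊕ᴿ αH) z w
  arc⁻′ (inj₁ x) (inj₁ y) a = let (ne , α) = arc⁻ g _ _ a in (λ e → ne (inj₁-injective e)) , α
  arc⁻′ (inj₂ x) (inj₂ y) a = let (ne , α) = arc⁻ h _ _ a in (λ e → ne (inj₂-injective e)) , α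

  arc⁺′ : ∀ z w → z ≢ w → (αG ⊕ᴿ αH) z w → arc (G · H) z w ≡ true
  arc⁺′ (inj₁ x) (inj₁ y) ne α = arc⁺ g _ _ (λ e → ne (cong inj₁ e)) α
  arc⁺′ (inj₂ x) (inj₂ y) ne α = arc⁺ h _ _ (λ e → ne (cong inj₂ e)) α

  edge⁻′ : ∀ z w → edge (G · H) z w ≡ true →
           z ≢ w × (εG ⊕ᴿ εH) z w × ¬ (αG ⊕ᴿ αH) z w × ¬ (αG ⊕ᴿ αH) w z
  edge⁻′ (inj₁ x) (inj₁ y) e = let (ne , rest) = edge⁻ g _ _ e in (λ e → ne (inj₁-injective e)) , rest
  edge⁻′ (inj₂ x) (inj₂ y) e = let (ne , rest) = edge⁻ h _ _ e in (λ e → ne (inj₂-injective e)) , rest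

  edge⁺′ : ∀ z w → z ≢ w → (εG ⊕ᴿ εH) z w →
           ¬ (αG ⊕ᴿ αH) z w → ¬ (αG ⊕ᴿ αH) w z → edge (G · H) z w ≡ true
  edge⁺′ (inj₁ x) (inj₁ y) ne e n₁ n₂ = edge⁺ g _ _ (λ e → ne (cong inj₁ e)) e n₁ n₂
  edge⁺′ (inj₂ x) (inj₂ y) ne e n₁ n₂ = edge⁺ h _ _ (λ e → ne (cong inj₂ e)) e n₁ n₂

mixedGraph-generated : ∀ {X} (G : MGraph X) → IsMixedGraph G →
                       Generated G (λ x y → arc G x y ≡ true) (λ x y → edge G x y ≡ true)
mixedGraph-generated G (no-loop , no-edge-loop , edge-sym , edge⇒¬arc) = record
  { arc⁻  = λ z w h → (λ { refl → false⇒¬true (no-loop z) h }) , h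
  ; arc⁺  = λ z w _ h → h
  ; edge⁻ = λ z w h → (λ { refl → false⇒¬true (no-edge-loop z) h }) , h ,
                      false⇒¬true (edge⇒¬arc z w h) ,
                      false⇒¬true (edge⇒¬arc w z (trans (edge-sym w z) h))
  ; edge⁺ = λ z w _ h _ _ → h }

joined : ∀ {X} → MGraph X → Carrier X → Carrier X → Bool
joined G x y = edge G x y Bool.∨ arc G x y Bool.∨ arc G y x

joined-edge : ∀ {X} (G : MGraph X) {x y} → edge G x y ≡ true → joined G x y ≡ true
joined-edge G {x} {y} h = ∨-inl (edge G x y) h

joined-arc : ∀ {X} (G : MGraph X) {x y} → arc G x y ≡ true → joined G x y ≡ true
joined-arc G {x} {y} h = ∨-inr (edge G x y) (∨-inl (arc G x y) h)

joined-arcᵒ : ∀ {X} (G : MGraph X) {x y} → arc G y x ≡ true → joined G x y ≡ true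
joined-arcᵒ G {x} {y} h = ∨-inr (edge G x y) (∨-inr (arc G x y) h)

joined-cases : ∀ {X} (G : MGraph X) x y → joined G x y ≡ true →
               edge G x y ≡ true ⊎ arc G x y ≡ true ⊎ arc G y x ≡ true
joined-cases G x y h with ∨-elim (edge G x y) _ h
... | inj₁ e = inj₁ e
... | inj₂ h′ = inj₂ (∨-elim (arc G x y) _ h′)

joined-sym : ∀ {X} (G : MGraph X) → (∀ x y → edge G x y ≡ edge G y x) →
             ∀ x y → joined G x y ≡ true → joined G y x ≡ true
joined-sym G edge-sym x y h with joined-cases G x y h
... | inj₁ e = joined-edge G (trans (edge-sym y x) e)
... | inj₂ (inj₁ a) = joined-arcᵒ G a
... | inj₂ (inj₂ a) = joined-arc G a

adjacent⁻ : ∀ {X} (G : MGraph X) P {x y} → Adjacent G P x y ≡ true →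
            P x ≡ true × P y ≡ true × joined G x y ≡ true
adjacent⁻ G P {x} {y} h = let (h₁ , h₂) = ∧-split (P x) _ h in h₁ , ∧-split (P y) _ h₂

adjacent⁺ : ∀ {X} (G : MGraph X) P {x y} → P x ≡ true → P y ≡ true → joined G x y ≡ true →
            Adjacent G P x y ≡ true
adjacent⁺ G P a b c = ∧-intro a (∧-intro b c)

adjacent-mono : ∀ {X} (G : MGraph X) {P P′} → (∀ z → P z ≡ true → P′ z ≡ true) →
                ∀ x y → Adjacent G P x y ≡ true → Adjacent G P′ x y ≡ true
adjacent-mono G {P} {P′} P⊆P′ x y h =
  let (px , py , j) = adjacent⁻ G P h in adjacent⁺ G P′ (P⊆P′ x px) (P⊆P′ y py) j

module _ {X} (G : MGraph X) (R : Equiv X) where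
  private
    q = quotG-generated G R

  joined-quot⁻ : ∀ c d → joined (quotG G R) c d ≡ true →
                 ∃ λ u → ∃ λ v → cl R u ≡ c × cl R v ≡ d × joined G u v ≡ true
  joined-quot⁻ c d h with joined-cases (quotG G R) c d h
  ... | inj₁ e = let (_ , (u , v , eu , ev , e′) , _) = edge⁻ q c d e in u , v , eu , ev , joined-edge G e′
  ... | inj₂ (inj₁ a) = let (_ , (u , v , eu , ev , a′)) = arc⁻ q c d a in u , v , eu , ev , joined-arc G a′
  ... | inj₂ (inj₂ a) = let (_ , (v , u , ev , eu , a′)) = arc⁻ q d c a in u , v , eu , ev , joined-arcᵒ G a′

  -- An edge of G may have become an arc of G/∼, but the two classes stay joined.
  joined-quot⁺ : ∀ u v → cl R u ≢ cl R v → joined G u v ≡ true → joined (quotG G R) (cl R u) (cl R v) ≡ true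
  joined-quot⁺ u v ne h with joined-cases G u v h
  ... | inj₂ (inj₁ a) = joined-arc (quotG G R) (arc⁺ q _ _ ne (u , v , refl , refl , a))
  ... | inj₂ (inj₂ a) = joined-arcᵒ (quotG G R) (arc⁺ q _ _ (≢-sym ne) (v , u , refl , refl , a))
  ... | inj₁ e with true? (arc (quotG G R) (cl R u) (cl R v)) | true? (arc (quotG G R) (cl R v) (cl R u))
  ...   | yes a | _ = joined-arc (quotG G R) a
  ...   | no _ | yes a = joined-arcᵒ (quotG G R) a
  ...   | no n₁ | no n₂ = joined-edge (quotG G R) (edge⁺ q _ _ ne (u , v , refl , refl , e)
          (λ a → n₁ (arc⁺ q _ _ ne a)) (λ a → n₂ (arc⁺ q _ _ (≢-sym ne) a)))

δ-inEc : ∀ {X} {G : MGraph X} {R} → InEc G R → δ R G ≡ just (quotG G R , restrG G R)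
δ-inEc {G = G} {R} ec with InEc? G R
... | yes _ = refl
... | no ¬ec = ⊥-elim (¬ec ec)

δ-¬inEc : ∀ {X} {G : MGraph X} {R} → ¬ InEc G R → δ R G ≡ nothing
δ-¬inEc {G = G} {R} ¬ec with InEc? G R
... | yes ec = ⊥-elim (¬ec ec)
... | no _ = refl

Δ-ideal : ∀ {X Y} {G : MGraph (X ⊎ˢ Y)} → IsIdealʳ {X} {Y} G → Δ G ≡ just (relabel inj₁ G , relabel inj₂ G)
Δ-ideal {X} {Y} {G} ideal with IsIdealʳ? {X} {Y} G
... | yes _ = refl
... | no ¬ideal = ⊥-elim (¬ideal ideal)

Δ-¬ideal : ∀ {X Y} {G : MGraph (X ⊎ˢ Y)} → ¬ IsIdealʳ {X} {Y} G → Δ G ≡ nothing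
Δ-¬ideal {X} {Y} {G} ¬ideal with IsIdealʳ? {X} {Y} G
... | yes ideal = ⊥-elim (¬ideal ideal)
... | no _ = refl

module _ {A A₁ A₂ B : Set} (f : A → Maybe (A₁ × A₂)) {m : Maybe (A × B)} {a b} (m≡ : m ≡ just (a , b)) where

  ⊗Id-just : ∀ {a₁ a₂} → f a ≡ just (a₁ , a₂) → (f ⊗Id) m ≡ just (a₁ , a₂ , b)
  ⊗Id-just fa≡ rewrite m≡ | fa≡ = refl

  ⊗Id-nothing : f a ≡ nothing → (f ⊗Id) m ≡ nothing
  ⊗Id-nothing fa≡ rewrite m≡ | fa≡ = refl

module _ {A B B₁ B₂ : Set} (f : B → Maybe (B₁ × B₂)) {m : Maybe (A × B)} {a b} (m≡ : m ≡ just (a , b)) where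

  Id⊗-just : ∀ {b₁ b₂} → f b ≡ just (b₁ , b₂) → (Id⊗ f) m ≡ just (a , b₁ , b₂)
  Id⊗-just fb≡ rewrite m≡ | fb≡ = refl

  Id⊗-nothing : f b ≡ nothing → (Id⊗ f) m ≡ nothing
  Id⊗-nothing fb≡ rewrite m≡ | fb≡ = refl

module _ {X Y} (RX : Equiv X) (RY : Equiv Y) {G₁ : MGraph X} {G₂ : MGraph Y} where

  δ⊗δ-just : ∀ {p q} → δ RX G₁ ≡ just p → δ RY G₂ ≡ just q →
             δ⊗δ RX RY (just (G₁ , G₂)) ≡ just (p , q)
  δ⊗δ-just e₁ e₂ rewrite e₁ | e₂ = refl

  δ⊗δ-nothingˡ : δ RX G₁ ≡ nothing → δ⊗δ RX RY (just (G₁ , G₂)) ≡ nothing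
  δ⊗δ-nothingˡ e₁ rewrite e₁ = refl

  δ⊗δ-nothingʳ : ∀ {p} → δ RX G₁ ≡ just p → δ RY G₂ ≡ nothing →
                 δ⊗δ RX RY (just (G₁ , G₂)) ≡ nothing
  δ⊗δ-nothingʳ e₁ e₂ rewrite e₁ | e₂ = refl

MaybeRel-subst : ∀ {A : Set} {_~_ : A → A → Set} {m m′ n n′} → m ≡ m′ → n ≡ n′ →
                 MaybeRel _~_ m′ n′ → MaybeRel _~_ m n
MaybeRel-subst refl refl r = r

-- Coassociativity

module Coassociativity {X} (G : MGraph X) (R R′ : Equiv X) (R⊆R′ : Finer R R′) where
  open Quot X R using (rep; rep-rel)

  private
    Q = quotG G R
    S = R′ ⧸ R
    R⇒R′ : ∀ {x y} → rel R x y ≡ true → rel R′ x y ≡ true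
    R⇒R′ = R⊆R′ _ _

  rel-reps : ∀ x y → rel R′ (rep x) (rep y) ≡ rel R′ x y
  rel-reps x y = bool-ext
    (λ h → rel-trans R′ (R⇒R′ (rel-rep R x)) (rel-trans R′ h (R⇒R′ (rep-rel y))))
    (λ h → rel-trans R′ (R⇒R′ (rep-rel x)) (rel-trans R′ h (R⇒R′ (rel-rep R y))))

  adjacent-restrict : ∀ x₀ x y → Adjacent (restrG G R′) (rel R x₀) x y ≡ Adjacent G (rel R x₀) x y
  adjacent-restrict x₀ x y with rel R x₀ x in e₁ | rel R x₀ y in e₂
  ... | false | _ = refl
  ... | true | false = refl
  ... | true | true
    rewrite R⊆R′ x y (rel-trans R (rel-sym R e₁) e₂) | R⊆R′ y x (rel-trans R (rel-sym R e₂) e₁)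
          | ∧-identityʳ (edge G x y) | ∧-identityʳ (arc G x y) | ∧-identityʳ (arc G y x) = refl

  inEc-restrict : InEc G R → InEc (restrG G R′) R
  inEc-restrict ec x₀ x y hx hy = walk-map (λ u v h → trans (adjacent-restrict x₀ u v) h) (ec x₀ x y hx hy)

  inEc-unrestrict : InEc (restrG G R′) R → InEc G R
  inEc-unrestrict ec x₀ x y hx hy = walk-map (λ u v h → trans (sym (adjacent-restrict x₀ u v)) h) (ec x₀ x y hx hy)

  within-class : InEc G R → ∀ {x₀ x y} → rel R′ x₀ x ≡ true → rel R x y ≡ true →
                 Walk (Adjacent G (rel R′ x₀)) x y
  within-class ec {x₀} {x} {y} hx xy =
    walk-map (adjacent-mono G (λ z h → rel-trans R′ hx (R⇒R′ h))) (ec x x y (rel-refl R x) xy)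

  -- Each step between classes is an edge or arc of G between some members; connectivity of the classes
  -- of ∼ fills in the gaps.
  lift-walk : InEc G R → ∀ x₀ {c d} → Walk (Adjacent Q (rel S (cl R x₀))) c d →
              ∀ {x y} → cl R x ≡ c → cl R y ≡ d → rel R′ x₀ x ≡ true →
              Walk (Adjacent G (rel R′ x₀)) x y
  lift-walk ec x₀ stay ex ey hx = within-class ec hx (cl≡⇒rel R (trans ex (sym ey)))
  lift-walk ec x₀ (step a w) ex ey hx =
    let (_ , pc′ , j) = adjacent⁻ Q (rel S (cl R x₀)) a
        (u , v , eu , ev , juv) = joined-quot⁻ G R _ _ j
        xu = cl≡⇒rel R (trans ex (sym eu))
        hu = rel-trans R′ hx (R⇒R′ xu)
        hv = rel-trans R′ (R⇒R′ (rel-rep R x₀)) (rel-trans R′ pc′ (R⇒R′ (rel-sym R (cl≡⇒rel-proj R ev))))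
    in walk-++ (within-class ec hx xu) (step (adjacent⁺ G (rel R′ x₀) hu hv juv) (lift-walk ec x₀ w ev ey hv))

  inEc-quot⇒inEc : InEc G R → InEc Q S → InEc G R′
  inEc-quot⇒inEc ecR ecQ x₀ x y hx hy =
    lift-walk ecR x₀ (ecQ (cl R x₀) (cl R x) (cl R y) (trans (rel-reps x₀ x) hx) (trans (rel-reps x₀ y) hy))
      refl refl hx

  project-walk : ∀ x₀ {x y} → Walk (Adjacent G (rel R′ x₀)) x y →
                 Walk (Adjacent Q (λ c → rel R′ x₀ (proj₁ c))) (cl R x) (cl R y)
  project-walk x₀ stay = stay
  project-walk x₀ (step {x = u} {y = v} a w) with FinSet._≟_ (X / R) (cl R u) (cl R v)
  ... | yes e rewrite e = project-walk x₀ w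
  ... | no ne =
    let (pu , pv , j) = adjacent⁻ G (rel R′ x₀) a in
    step (adjacent⁺ Q (λ c → rel R′ x₀ (proj₁ c)) (rel-trans R′ pu (R⇒R′ (rel-rep R u)))
                    (rel-trans R′ pv (R⇒R′ (rel-rep R v))) (joined-quot⁺ G R u v ne j))
         (project-walk x₀ w)

  inEc⇒inEc-quot : InEc G R′ → InEc Q S
  inEc⇒inEc-quot ec c₀ c d hc hd =
    subst₂ (Walk _) (cl-proj R c) (cl-proj R d)
      (project-walk (proj₁ c₀) (ec (proj₁ c₀) (proj₁ c) (proj₁ d) hc hd))

  φ-fibre : ∀ x a → cl S (cl R x) ≡ φ R R′ a ⇔ cl R′ x ≡ a
  φ-fibre x a = mk⇔
    (λ e → rel-proj⇒cl≡ R′ (trans (sym (rel-reps x (proj₁ a))) (cl≡⇒rel S e)))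
    (λ e → rel⇒cl≡ S (trans (rel-reps x (proj₁ a)) (cl≡⇒rel-proj R′ e)))

  φ-injective : ∀ {a b} → φ R R′ a ≡ φ R R′ b → a ≡ b
  φ-injective {a} {b} e = trans (sym (cl-proj R′ a)) (to (φ-fibre (proj₁ a) b) e)

  quot-quot≅quot : relabel (φ R R′) (quotG Q S) ≅ quotG G R′
  quot-quot≅quot = generated-≅ (relabel-generated (φ R R′) φ-injective (quotG-generated Q S))
                               (quotG-generated G R′) arcs⇔ edges⇔
    where
    q = quotG-generated G R

    separate : ∀ {x y a b} → a ≢ b → cl R′ x ≡ a → cl R′ y ≡ b → cl R x ≢ cl R y
    separate ne ex ey e = ne (trans (sym ex) (trans (rel⇒cl≡ R′ (R⇒R′ (cl≡⇒rel R e))) ey))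

    arcs⇔ : ∀ a b → a ≢ b → Image² (cl S) (arc Q) (φ R R′ a) (φ R R′ b) ⇔ Image² (cl R′) (arc G) a b
    arcs⇔ a b ne = mk⇔
      (λ (c , d , ec , ed , h) → let (_ , (x , y , ex , ey , axy)) = arc⁻ q c d h in
         x , y , to (φ-fibre x a) (subst (λ c → cl S c ≡ _) (sym ex) ec) ,
                 to (φ-fibre y b) (subst (λ d → cl S d ≡ _) (sym ey) ed) , axy)
      (λ (x , y , ex , ey , axy) → cl R x , cl R y , from (φ-fibre x a) ex , from (φ-fibre y b) ey ,
         arc⁺ q _ _ (separate ne ex ey) (x , y , refl , refl , axy))

    edges⇔ : ∀ a b → a ≢ b → ¬ Image² (cl S) (arc Q) (φ R R′ a) (φ R R′ b) →
             ¬ Image² (cl S) (arc Q) (φ R R′ b) (φ R R′ a) →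
             Image² (cl S) (edge Q) (φ R R′ a) (φ R R′ b) ⇔ Image² (cl R′) (edge G) a b
    edges⇔ a b ne n₁ n₂ = mk⇔
      (λ (c , d , ec , ed , h) → let (_ , (x , y , ex , ey , exy) , _) = edge⁻ q c d h in
         x , y , to (φ-fibre x a) (subst (λ c → cl S c ≡ _) (sym ex) ec) ,
                 to (φ-fibre y b) (subst (λ d → cl S d ≡ _) (sym ey) ed) , exy)
      (λ (x , y , ex , ey , exy) →
         let ex′ = from (φ-fibre x a) ex ; ey′ = from (φ-fibre y b) ey ; sep = separate ne ex ey in
         cl R x , cl R y , ex′ , ey′ ,
         edge⁺ q _ _ sep (x , y , refl , refl , exy)
           (λ axy → n₁ (cl R x , cl R y , ex′ , ey′ , arc⁺ q _ _ sep axy))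
           (λ ayx → n₂ (cl R y , cl R x , ey′ , ex′ , arc⁺ q _ _ (≢-sym sep) ayx)))

  restrict-image : ∀ (r : Carrier X → Carrier X → Bool) c d →
                   (Image² (cl R) r c d × rel S c d ≡ true) ⇔ Image² (cl R) (λ x y → r x y ∧ rel R′ x y) c d
  restrict-image r c d = mk⇔
    (λ { ((x , y , refl , refl , h) , s) → x , y , refl , refl , ∧-intro h (trans (sym (rel-reps x y)) s) })
    (λ { (x , y , refl , refl , h) →
           (x , y , refl , refl , ∧-elimˡ (r x y) h) , trans (rel-reps x y) (∧-elimʳ (r x y) h) })

  restr-quot≅quot-restr : restrG Q S ≅ quotG (restrG G R′) R
  restr-quot≅quot-restr =
    generated-≅ (restrG-generated S (quotG-generated G R))
                (quotG-generated (restrG G R′) R)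
                (λ c d _ → restrict-image (arc G) c d) (λ c d _ _ _ → restrict-image (edge G) c d)

  restr≅restr-restr : restrG G R ≅ restrG (restrG G R′) R
  restr≅restr-restr = (λ x y → ∧-restrict-twice (arc G x y) (R⊆R′ x y)) ,
                      (λ x y → ∧-restrict-twice (edge G x y) (R⊆R′ x y))
    where
    ∧-restrict-twice : ∀ a {s s′} → (s ≡ true → s′ ≡ true) → a ∧ s ≡ (a ∧ s′) ∧ s
    ∧-restrict-twice a {s} {s′} s⇒s′ = begin
      a ∧ s          ≡⟨ cong (a ∧_) (sym (∧-implied s s⇒s′)) ⟩
      a ∧ (s ∧ s′)   ≡⟨ cong (a ∧_) (∧-comm s s′) ⟩
      a ∧ (s′ ∧ s)   ≡⟨ sym (∧-assoc a s′ s) ⟩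
      (a ∧ s′) ∧ s   ∎
      where open ≡-Reasoning

  δ-coassoc : map (λ { (A , B , C) → relabel (φ R R′) A , B , C }) ((δ S ⊗Id) (δ R G))
                ≈₃ (Id⊗ δ R) (δ R′ G)
  δ-coassoc = by-cases (InEc? G R) (InEc? G R′)
    where
    g : MGraph ((X / R) / S) × MGraph (X / R) × MGraph X → MGraph (X / R′) × MGraph (X / R) × MGraph X
    g (A , B , C) = relabel (φ R R′) A , B , C

    by-cases : Dec (InEc G R) → Dec (InEc G R′) → map g ((δ S ⊗Id) (δ R G)) ≈₃ (Id⊗ δ R) (δ R′ G)
    by-cases (yes ecR) (yes ecR′) =
      MaybeRel-subst (cong (map g) (⊗Id-just (δ S) (δ-inEc ecR) (δ-inEc (inEc⇒inEc-quot ecR′))))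
                     (Id⊗-just (δ R) (δ-inEc ecR′) (δ-inEc (inEc-restrict ecR)))
                     (just (quot-quot≅quot , restr-quot≅quot-restr , restr≅restr-restr))
    by-cases (yes ecR) (no ¬ecR′) =
      MaybeRel-subst (cong (map g) (⊗Id-nothing (δ S) (δ-inEc ecR)
                                     (δ-¬inEc (λ ecQ → ¬ecR′ (inEc-quot⇒inEc ecR ecQ)))))
                     (cong (Id⊗ δ R) (δ-¬inEc ¬ecR′)) nothing
    by-cases (no ¬ecR) (yes ecR′) =
      MaybeRel-subst (cong (λ m → map g ((δ S ⊗Id) m)) (δ-¬inEc ¬ecR))
                     (Id⊗-nothing (δ R) (δ-inEc ecR′) (δ-¬inEc (λ ec → ¬ecR (inEc-unrestrict ec)))) nothing
    by-cases (no ¬ecR) (no ¬ecR′) =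
      MaybeRel-subst (cong (λ m → map g ((δ S ⊗Id) m)) (δ-¬inEc ¬ecR))
                     (cong (Id⊗ δ R) (δ-¬inEc ¬ecR′)) nothing

-- Counit

module _ {X} (G : MGraph X) (R : Equiv X) (eq : IsEqualityRel R) where

  inEc-equality : InEc G R
  inEc-equality x₀ x y hx hy with trans (sym (proj₁ (eq x₀ x) hx)) (proj₁ (eq x₀ y) hy)
  ... | refl = stay

  restrG-equality-empty : IsMixedGraph G → NoEdgeNoArc (restrG G R)
  restrG-equality-empty (no-loop , no-edge-loop , _) x y with true? (rel R x y)
  ... | no ¬xy = both-false (¬-not ¬xy)
    where
    both-false : rel R x y ≡ false → arc G x y ∧ rel R x y ≡ false × edge G x y ∧ rel R x y ≡ false
    both-false e rewrite e = ∧-zeroʳ (arc G x y) , ∧-zeroʳ (edge G x y)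
  ... | yes xy with proj₁ (eq x y) xy
  ... | refl rewrite no-loop x | no-edge-loop x = refl , refl

  cl-equality-injective : ∀ {x y} → cl R x ≡ cl R y → x ≡ y
  cl-equality-injective e = proj₁ (eq _ _) (cl≡⇒rel R e)

  image-cl-equality : ∀ (r : Carrier X → Carrier X → Bool) x y →
                      Image² (cl R) r (cl R x) (cl R y) ⇔ (r x y ≡ true)
  image-cl-equality r x y = mk⇔
    (λ (u , v , eu , ev , h) → subst₂ (λ u v → r u v ≡ true) (cl-equality-injective eu) (cl-equality-injective ev) h)
    (λ h → x , y , refl , refl , h)

  relabel-quotG-equality : IsMixedGraph G → relabel (cl R) (quotG G R) ≅ G
  relabel-quotG-equality mg =
    generated-≅ (relabel-generated (cl R) cl-equality-injective (quotG-generated G R)) (mixedGraph-generated G mg)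
                (λ x y _ → image-cl-equality (arc G) x y) (λ x y _ _ _ → image-cl-equality (edge G) x y)

  δ-counitʳ-equality : IsMixedGraph G → map (relabel (cl R)) (Id⊗εδ∘δ R G) ≈₁ just G
  δ-counitʳ-equality mg with InEc? G R
  ... | no ¬ec = ⊥-elim (¬ec inEc-equality)
  ... | yes _ with NoEdgeNoArc? (restrG G R)
  ...   | no ¬empty = ⊥-elim (¬empty (restrG-equality-empty mg))
  ...   | yes _ = just (relabel-quotG-equality mg)

¬equality⇒related-pair : ∀ {X} (R : Equiv X) → ¬ IsEqualityRel R →
                         ∃ λ x → ∃ λ y → rel R x y ≡ true × x ≢ y
¬equality⇒related-pair {X} R ¬eq with ∃? X (λ x → ∃? X (λ y → true? (rel R x y) ×-dec ¬? (FinSet._≟_ X x y)))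
... | yes pair = pair
... | no ¬pair = ⊥-elim (¬eq (λ x y → related⇒≡ x y , λ { refl → rel-refl R x }))
  where
  related⇒≡ : ∀ x y → rel R x y ≡ true → x ≡ y
  related⇒≡ x y h with FinSet._≟_ X x y
  ... | yes e = e
  ... | no ne = ⊥-elim (¬pair (x , y , h , ne))

-- Two distinct related vertices are joined by a walk inside their class, whose first step survives in G∣∼.
inEc-nonequality-nonempty : ∀ {X} (G : MGraph X) (R : Equiv X) → InEc G R → ¬ IsEqualityRel R →
                            ¬ NoEdgeNoArc (restrG G R)
inEc-nonequality-nonempty G R ec ¬eq empty with ¬equality⇒related-pair R ¬eq
... | x , y , xy , x≢y with ec x x y (rel-refl R x) xy
...   | stay = x≢y refl
...   | step {y = w} a _ with adjacent⁻ G (rel R x) a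
...     | _ , xw , j with joined-cases G x w j
...       | inj₁ e = false⇒¬true (proj₂ (empty x w)) (∧-intro e xw)
...       | inj₂ (inj₁ a′) = false⇒¬true (proj₁ (empty x w)) (∧-intro a′ xw)
...       | inj₂ (inj₂ a′) = false⇒¬true (proj₁ (empty w x)) (∧-intro a′ (rel-sym R xw))

δ-counitʳ-nonequality : ∀ {X} (G : MGraph X) (R : Equiv X) → ¬ IsEqualityRel R → Id⊗εδ∘δ R G ≈₁ nothing
δ-counitʳ-nonequality G R ¬eq with InEc? G R
... | no _ = nothing
... | yes ec with NoEdgeNoArc? (restrG G R)
...   | no _ = nothing
...   | yes empty = ⊥-elim (inEc-nonequality-nonempty G R ec ¬eq empty)

≅-sym : ∀ {X} {G H : MGraph X} → G ≅ H → H ≅ G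
≅-sym (a , e) = (λ x y → sym (a x y)) , (λ x y → sym (e x y))

≅-trans : ∀ {X} {G H K : MGraph X} → G ≅ H → H ≅ K → G ≅ K
≅-trans (a , e) (a′ , e′) = (λ x y → trans (a x y) (a′ x y)) , (λ x y → trans (e x y) (e′ x y))

-- Characterises "lies in the same connected component of G".
IsComponentRel : ∀ {X} → MGraph X → Equiv X → Set
IsComponentRel G R = InEc G R × (∀ x y → joined G x y ≡ true → rel R x y ≡ true)

module Components {X} (G : MGraph X) (mg : IsMixedGraph G) where

  walk⇒rel : ∀ {P} (R : Equiv X) → (∀ u v → joined G u v ≡ true → rel R u v ≡ true) →
             ∀ {x y} → Walk (Adjacent G P) x y → rel R x y ≡ true
  walk⇒rel R joined⇒R {x} stay = rel-refl R x
  walk⇒rel {P} R joined⇒R (step a w) =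
    rel-trans R (joined⇒R _ _ (proj₂ (proj₂ (adjacent⁻ G P a)))) (walk⇒rel {P} R joined⇒R w)

  componentRel-unique : ∀ {R R′} → IsComponentRel G R → IsComponentRel G R′ → SameRel R R′
  componentRel-unique {R} {R′} (ec , joined⇒R) (ec′ , joined⇒R′) x y = bool-ext
    (λ h → walk⇒rel {rel R x} R′ joined⇒R′ (ec x x y (rel-refl R x) h))
    (λ h → walk⇒rel {rel R′ x} R joined⇒R (ec′ x x y (rel-refl R′ x) h))

  componentRel-resp : ∀ {R R′} → SameRel R R′ → IsComponentRel G R → IsComponentRel G R′
  componentRel-resp {R} {R′} same (ec , joined⇒R) =
    (λ x₀ x y hx hy → walk-map (adjacent-mono G (λ z h → trans (sym (same x₀ z)) h))
                               (ec x₀ x y (trans (same x₀ x) hx) (trans (same x₀ y) hy))) ,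
    (λ x y h → trans (sym (same x y)) (joined⇒R x y h))

  restrG-componentRel : ∀ {R} → IsComponentRel G R → restrG G R ≅ G
  restrG-componentRel {R} (_ , joined⇒R) =
    (λ x y → ∧-implied (arc G x y) (λ a → joined⇒R x y (joined-arc G a))) ,
    (λ x y → ∧-implied (edge G x y) (λ e → joined⇒R x y (joined-edge G e)))

  quotG-componentRel-empty : ∀ {R} → IsComponentRel G R → NoEdgeNoArc (quotG G R)
  quotG-componentRel-empty {R} (_ , joined⇒R) c d =
    ¬-not (λ h → let (ne , x , y , ex , ey , a) = arc⁻ q c d h in
                 ne (trans (sym ex) (trans (rel⇒cl≡ R (joined⇒R x y (joined-arc G a))) ey))) ,
    ¬-not (λ h → let (ne , (x , y , ex , ey , e) , _) = edge⁻ q c d h in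
                 ne (trans (sym ex) (trans (rel⇒cl≡ R (joined⇒R x y (joined-edge G e))) ey)))
    where q = quotG-generated G R

  quotG-empty⇒componentRel : ∀ {R} → InEc G R → NoEdgeNoArc (quotG G R) → IsComponentRel G R
  quotG-empty⇒componentRel {R} ec empty = ec , joined⇒R
    where
    joined⇒R : ∀ x y → joined G x y ≡ true → rel R x y ≡ true
    joined⇒R x y h with true? (rel R x y)
    ... | yes xy = xy
    ... | no ¬xy with joined-cases (quotG G R) _ _ (joined-quot⁺ G R x y (λ e → ¬xy (cl≡⇒rel R e)) h)
    ...   | inj₁ e = ⊥-elim (false⇒¬true (proj₂ (empty _ _)) e)
    ...   | inj₂ (inj₁ a) = ⊥-elim (false⇒¬true (proj₁ (empty _ _)) a)
    ...   | inj₂ (inj₂ a) = ⊥-elim (false⇒¬true (proj₁ (empty _ _)) a)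

  private
    edge-sym = proj₁ (proj₂ (proj₂ mg))

    connected : Carrier X → Carrier X → Bool
    connected x y = ⌊ Walk? {X} (joined G) x y ⌋

    connected⁻ : ∀ {x y} → connected x y ≡ true → Walk (joined G) x y
    connected⁻ {x} {y} = ⌊⌋-true⁻ (Walk? {X} (joined G) x y)

    connected⁺ : ∀ {x y} → Walk (joined G) x y → connected x y ≡ true
    connected⁺ {x} {y} = ⌊⌋-true⁺ (Walk? {X} (joined G) x y)

  components : Equiv X
  components = record
    { rel = connected
    ; rel-refl = λ x → connected⁺ stay
    ; rel-sym = λ h → connected⁺ (walk-reverse (joined-sym G edge-sym) (connected⁻ h))
    ; rel-trans = λ h h′ → connected⁺ (walk-++ (connected⁻ h) (connected⁻ h′)) }

  components-isComponentRel : IsComponentRel G components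
  components-isComponentRel =
    (λ x₀ x y hx hy → inside x₀ (connected⁻ hx)
      (walk-++ (walk-reverse (joined-sym G edge-sym) (connected⁻ hx)) (connected⁻ hy))) ,
    (λ x y h → connected⁺ (step h stay))
    where
    inside : ∀ x₀ {a b} → Walk (joined G) x₀ a → Walk (joined G) a b → Walk (Adjacent G (connected x₀)) a b
    inside x₀ r stay = stay
    inside x₀ r (step h w) =
      step (adjacent⁺ G (connected x₀) (connected⁺ r) (connected⁺ (walk-snoc r h)) h) (inside x₀ (walk-snoc r h) w)

  module _ {c ℓ} (K : CommutativeRing c ℓ) (H : MGraph X) where
    open CommutativeRing K using (0#; 1#)

    coeff-counitˡ-component : ∀ {R} → IsComponentRel G R →
                              Coeff.coeff K (εδ⊗Id∘δ R G) H ≡ Coeff.coeff K (just G) H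
    coeff-counitˡ-component {R} comp with InEc? G R
    ... | no ¬ec = ⊥-elim (¬ec (proj₁ comp))
    ... | yes _ with NoEdgeNoArc? (quotG G R)
    ...   | no ¬empty = ⊥-elim (¬empty (quotG-componentRel-empty comp))
    ...   | yes _ = cong (λ b → if b then 1# else 0#) (⌊⌋-⇔ (restrG G R ≅? H) (G ≅? H)
                      (mk⇔ (≅-trans {G = G} {restrG G R} {H} (≅-sym {G = restrG G R} {G} restr≅G))
                           (≅-trans {G = restrG G R} {G} {H} restr≅G)))
      where
      restr≅G : restrG G R ≅ G
      restr≅G = restrG-componentRel {R} comp

    coeff-counitˡ-other : ∀ {R} → ¬ IsComponentRel G R → Coeff.coeff K (εδ⊗Id∘δ R G) H ≡ 0#
    coeff-counitˡ-other {R} ¬comp with InEc? G R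
    ... | no _ = refl
    ... | yes ec with NoEdgeNoArc? (quotG G R)
    ...   | no _ = refl
    ...   | yes empty = ⊥-elim (¬comp (quotG-empty⇒componentRel ec empty))

filter-∈-sublists : ∀ {A : Set} {P : A → Set} (P? : ∀ a → Dec (P a)) xs → filter P? xs ∈ sublists xs
filter-∈-sublists P? [] = here refl
filter-∈-sublists P? (x ∷ xs) with does (P? x)
... | true = ∈-++⁺ʳ (sublists xs) (∈-map⁺ (x ∷_) (filter-∈-sublists P? xs))
... | false = ∈-++⁺ˡ (filter-∈-sublists P? xs)

module _ (X : FinSet) where
  private
    _≟X_ = FinSet._≟_ X
    Pairs = cartesianProduct (elems X) (elems X)

  relOf-∈⁺ : ∀ S {x y} → (x , y) ∈ S → relOf X S x y ≡ true
  relOf-∈⁺ ((a , b) ∷ S) (here refl) =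
    ∨-inl (⌊ a ≟X a ⌋ ∧ ⌊ b ≟X b ⌋) (∧-intro (⌊⌋-true⁺ (a ≟X a) refl) (⌊⌋-true⁺ (b ≟X b) refl))
  relOf-∈⁺ ((a , b) ∷ S) {x} {y} (there i) = ∨-inr (⌊ a ≟X x ⌋ ∧ ⌊ b ≟X y ⌋) (relOf-∈⁺ S i)

  relOf-∈⁻ : ∀ S {x y} → relOf X S x y ≡ true → (x , y) ∈ S
  relOf-∈⁻ ((a , b) ∷ S) {x} {y} h with ∨-elim (⌊ a ≟X x ⌋ ∧ ⌊ b ≟X y ⌋) _ h
  ... | inj₂ h′ = there (relOf-∈⁻ S h′)
  ... | inj₁ h′
    with ⌊⌋-true⁻ (a ≟X x) (∧-elimˡ ⌊ a ≟X x ⌋ h′) | ⌊⌋-true⁻ (b ≟X y) (∧-elimʳ ⌊ a ≟X x ⌋ h′)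
  ...   | refl | refl = here refl

  related? : (R : Equiv X) (p : Carrier X × Carrier X) → Dec (rel R (proj₁ p) (proj₂ p) ≡ true)
  related? R (x , y) = rel R x y Bool.≟ true

  relOf-related : ∀ (R : Equiv X) x y → relOf X (filter (related? R) Pairs) x y ≡ rel R x y
  relOf-related R x y = bool-ext
    (λ h → proj₂ (∈-filter⁻ (related? R) {xs = Pairs} (relOf-∈⁻ (filter (related? R) Pairs) h)))
    (λ h → relOf-∈⁺ _ (∈-filter⁺ (related? R) (∈-cartesianProduct⁺ (complete X x) (complete X y)) h))

  toEquiv-equivalence : ∀ (r : Carrier X → Carrier X → Bool) → (∀ x → r x x ≡ true) →
    (∀ x y → r x y ≡ true → r y x ≡ true) → (∀ x y z → r x y ≡ true → r y z ≡ true → r x z ≡ true) →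
    Maybeᴬ.Any (λ E → ∀ x y → rel E x y ≡ r x y) (toEquiv X r)
  toEquiv-equivalence r rf sy tr
    with ∀? X (λ x → true? (r x x))
       | ∀? X (λ x → ∀? X (λ y → true? (r x y) →-dec true? (r y x)))
       | ∀? X (λ x → ∀? X (λ y → ∀? X (λ z → true? (r x y) →-dec (true? (r y z) →-dec true? (r x z)))))
  ... | yes _ | yes _ | yes _ = Maybeᴬ.just (λ x y → refl)
  ... | no ¬rf | _ | _ = ⊥-elim (¬rf rf)
  ... | yes _ | no ¬sy | _ = ⊥-elim (¬sy sy)
  ... | yes _ | yes _ | no ¬tr = ⊥-elim (¬tr tr)

  -- R is found from the sublist of pairs it relates.
  Equivs-complete : ∀ (R : Equiv X) → Any (λ E → SameRel E R) (Equivs X)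
  Equivs-complete R =
    Anyₚ.deduplicate⁺ (SameRel? X) (λ same same′ x y → trans (same x y) (same′ x y))
      (Anyₚ.mapMaybe⁺ (toEquiv X) (List.map (relOf X) (sublists Pairs))
        (Anyₚ.map⁺ (Anyₚ.map⁺ (Any.map (λ { refl → found }) (filter-∈-sublists (related? R) Pairs)))))
    where
    r = relOf X (filter (related? R) Pairs)
    r≡R = relOf-related R
    found : Maybeᴬ.Any (λ E → SameRel E R) (toEquiv X r)
    found = Maybeᴬ.map (λ rel≡r x y → trans (rel≡r x y) (r≡R x y))
      (toEquiv-equivalence r
        (λ x → trans (r≡R x x) (rel-refl R x))
        (λ x y h → trans (r≡R y x) (rel-sym R (trans (sym (r≡R x y)) h)))
        (λ x y z h h′ → trans (r≡R x z) (rel-trans R (trans (sym (r≡R x y)) h) (trans (sym (r≡R y z)) h′))))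

  Equivs-unique : AllPairs (λ R R′ → ¬ SameRel R R′) (Equivs X)
  Equivs-unique = Uniqueₚ.deduplicate-! sameRel-decSetoid _
    where
    sameRel-decSetoid : DecSetoid Level.zero Level.zero
    sameRel-decSetoid = record
      { Carrier = Equiv X ; _≈_ = SameRel
      ; isDecEquivalence = record
        { isEquivalence = record { refl = λ x y → refl ; sym = λ h x y → sym (h x y)
                                 ; trans = λ h h′ x y → trans (h x y) (h′ x y) }
        ; _≟_ = SameRel? X } }

module _ {c ℓ} (K : CommutativeRing c ℓ) where
  open CommutativeRing K using (_≈_; 0#; +-cong; +-identityˡ; +-identityʳ; reflexive)
    renaming (Carrier to ∣K∣; refl to ≈-refl; trans to ≈-trans)

  ∑-zero : ∀ {A : Set} (f : A → ∣K∣) xs → All (λ a → f a ≡ 0#) xs → Coeff.∑ K xs f ≈ 0#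
  ∑-zero f [] [] = ≈-refl
  ∑-zero f (a ∷ xs) (fa≡0 ∷ rest) = ≈-trans (+-cong (reflexive fa≡0) (∑-zero f xs rest)) (+-identityˡ 0#)

  ∑-single : ∀ {A : Set} {P : A → Set} (P? : ∀ a → Dec (P a)) (f : A → ∣K∣) {v} →
             (∀ {a} → P a → f a ≡ v) → (∀ {a} → ¬ P a → f a ≡ 0#) →
             ∀ xs → AllPairs (λ a b → ¬ (P a × P b)) xs → Any P xs → Coeff.∑ K xs f ≈ v
  ∑-single P? f {v} on off (a ∷ xs) (a∉ ∷ _) (here pa) =
    ≈-trans (+-cong (reflexive (on pa)) (∑-zero f xs (All.map (λ ¬both → off (λ pb → ¬both (pa , pb))) a∉)))
            (+-identityʳ v)
  ∑-single P? f {v} on off (a ∷ xs) (a∉ ∷ distinct) (there p∈) with P? a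
  ... | yes pa = ⊥-elim (All¬⇒¬Any (All.map (λ ¬both pb → ¬both (pa , pb)) a∉) p∈)
  ... | no ¬pa = ≈-trans (+-cong (reflexive (off ¬pa)) (∑-single P? f on off xs distinct p∈)) (+-identityˡ v)

δ-counitˡ : ∀ {c ℓ} (K : CommutativeRing c ℓ) {X} (G : MGraph X) → IsMixedGraph G → ∀ (H : MGraph X) →
            CommutativeRing._≈_ K (Coeff.∑ K (Equivs X) (λ R → Coeff.coeff K (εδ⊗Id∘δ R G) H))
                                  (Coeff.coeff K (just G) H)
δ-counitˡ K {X} G mg H =
  ∑-single K componentRel? (λ R → Coeff.coeff K (εδ⊗Id∘δ R G) H)
    (coeff-counitˡ-component K H) (coeff-counitˡ-other K H) (Equivs X)
    (AllPairs.map (λ {R} {R′} ¬same (comp , comp′) → ¬same (componentRel-unique {R} {R′} comp comp′))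
                  (Equivs-unique X))
    (Any.map (λ {R} same → componentRel-resp {components} {R} (λ x y → sym (same x y))
                                               components-isComponentRel)
             (Equivs-complete X components))
  where
  open Components G mg
  componentRel? : ∀ R → Dec (IsComponentRel G R)
  componentRel? R = InEc? G R ×-dec ∀? X (λ x → ∀? X (λ y → true? (joined G x y) →-dec true? (rel R x y)))

-- Disjoint unions

module DisjointUnion {X Y : FinSet} (RX : Equiv X) (RY : Equiv Y) where
  private
    R = RX ⊕ RY

  cl⊕-fibre₁ : ∀ u a → cl R u ≡ ψ RX RY (inj₁ a) → ∃ λ x → u ≡ inj₁ x × cl RX x ≡ a
  cl⊕-fibre₁ u a e with cl≡⇒rel R e
  cl⊕-fibre₁ (inj₁ x) a e | h = x , refl , rel-proj⇒cl≡ RX h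

  cl⊕-fibre₂ : ∀ u b → cl R u ≡ ψ RX RY (inj₂ b) → ∃ λ y → u ≡ inj₂ y × cl RY y ≡ b
  cl⊕-fibre₂ u b e with cl≡⇒rel R e
  cl⊕-fibre₂ (inj₂ y) b e | h = y , refl , rel-proj⇒cl≡ RY h

  cl⊕-inj₁ : ∀ {x a} → cl RX x ≡ a → cl R (inj₁ x) ≡ ψ RX RY (inj₁ a)
  cl⊕-inj₁ e = rel⇒cl≡ R (cl≡⇒rel-proj RX e)

  cl⊕-inj₂ : ∀ {y b} → cl RY y ≡ b → cl R (inj₂ y) ≡ ψ RX RY (inj₂ b)
  cl⊕-inj₂ e = rel⇒cl≡ R (cl≡⇒rel-proj RY e)

  ψ-injective : ∀ {z w} → ψ RX RY z ≡ ψ RX RY w → z ≡ w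
  ψ-injective {inj₁ a} {inj₁ b} e with cl⊕-fibre₁ (inj₁ (proj₁ a)) b e
  ... | _ , refl , ex = cong inj₁ (trans (sym (cl-proj RX a)) ex)
  ψ-injective {inj₂ a} {inj₂ b} e with cl⊕-fibre₂ (inj₂ (proj₁ a)) b e
  ... | _ , refl , ey = cong inj₂ (trans (sym (cl-proj RY a)) ey)
  ψ-injective {inj₁ a} {inj₂ b} e with cl⊕-fibre₂ (inj₁ (proj₁ a)) b e
  ... | _ , () , _
  ψ-injective {inj₂ a} {inj₁ b} e with cl⊕-fibre₁ (inj₂ (proj₁ a)) b e
  ... | _ , () , _

  module _ (r : Carrier X ⊎ Carrier Y → Carrier X ⊎ Carrier Y → Bool) where

    image-ψ₁ : ∀ a b → Image² (cl R) r (ψ RX RY (inj₁ a)) (ψ RX RY (inj₁ b)) ⇔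
                       Image² (cl RX) (λ x x′ → r (inj₁ x) (inj₁ x′)) a b
    image-ψ₁ a b =
      mk⇔ to′ (λ (x , x′ , ex , ex′ , h) → inj₁ x , inj₁ x′ , cl⊕-inj₁ ex , cl⊕-inj₁ ex′ , h)
      where
      to′ : Image² (cl R) r (ψ RX RY (inj₁ a)) (ψ RX RY (inj₁ b)) →
            Image² (cl RX) (λ x x′ → r (inj₁ x) (inj₁ x′)) a b
      to′ (u , v , eu , ev , h) with cl⊕-fibre₁ u a eu | cl⊕-fibre₁ v b ev
      ... | x , refl , ex | x′ , refl , ex′ = x , x′ , ex , ex′ , h

    image-ψ₂ : ∀ a b → Image² (cl R) r (ψ RX RY (inj₂ a)) (ψ RX RY (inj₂ b)) ⇔
                       Image² (cl RY) (λ y y′ → r (inj₂ y) (inj₂ y′)) a b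
    image-ψ₂ a b =
      mk⇔ to′ (λ (y , y′ , ey , ey′ , h) → inj₂ y , inj₂ y′ , cl⊕-inj₂ ey , cl⊕-inj₂ ey′ , h)
      where
      to′ : Image² (cl R) r (ψ RX RY (inj₂ a)) (ψ RX RY (inj₂ b)) →
            Image² (cl RY) (λ y y′ → r (inj₂ y) (inj₂ y′)) a b
      to′ (u , v , eu , ev , h) with cl⊕-fibre₂ u a eu | cl⊕-fibre₂ v b ev
      ... | y , refl , ey | y′ , refl , ey′ = y , y′ , ey , ey′ , h

    image-ψ₁₂ : ∀ a b → Image² (cl R) r (ψ RX RY (inj₁ a)) (ψ RX RY (inj₂ b)) →
                ∃ λ x → ∃ λ y → r (inj₁ x) (inj₂ y) ≡ true
    image-ψ₁₂ a b (u , v , eu , ev , h) with cl⊕-fibre₁ u a eu | cl⊕-fibre₂ v b ev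
    ... | x , refl , _ | y , refl , _ = x , y , h

    image-ψ₂₁ : ∀ a b → Image² (cl R) r (ψ RX RY (inj₂ a)) (ψ RX RY (inj₁ b)) →
                ∃ λ y → ∃ λ x → r (inj₂ y) (inj₁ x) ≡ true
    image-ψ₂₁ a b (u , v , eu , ev , h) with cl⊕-fibre₂ u a eu | cl⊕-fibre₁ v b ev
    ... | y , refl , _ | x , refl , _ = y , x , h

  module _ (G : MGraph (X ⊎ˢ Y)) where
    private
      G₁ = relabel {X ⊎ˢ Y} {X} inj₁ G
      G₂ = relabel {X ⊎ˢ Y} {Y} inj₂ G
      q = quotG-generated G R

    -- A walk inside a class of ∼X ⊔ ∼Y never changes sides.
    walk⊕₁ : ∀ x₀ {x v} → Walk (Adjacent G (rel R (inj₁ x₀))) (inj₁ x) v → ∀ {x′} → v ≡ inj₁ x′ →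
             Walk (Adjacent G₁ (rel RX x₀)) x x′
    walk⊕₁ x₀ stay refl = stay
    walk⊕₁ x₀ (step {y = inj₁ _} a w) e = step a (walk⊕₁ x₀ w e)
    walk⊕₁ x₀ {x} (step {y = inj₂ y} a w) e with adjacent⁻ G (rel R (inj₁ x₀)) {inj₁ x} {inj₂ y} a
    ... | _ , () , _

    walk⊕₂ : ∀ y₀ {y v} → Walk (Adjacent G (rel R (inj₂ y₀))) (inj₂ y) v → ∀ {y′} → v ≡ inj₂ y′ →
             Walk (Adjacent G₂ (rel RY y₀)) y y′
    walk⊕₂ y₀ stay refl = stay
    walk⊕₂ y₀ (step {y = inj₂ _} a w) e = step a (walk⊕₂ y₀ w e)
    walk⊕₂ y₀ {y} (step {y = inj₁ x} a w) e with adjacent⁻ G (rel R (inj₂ y₀)) {inj₂ y} {inj₁ x} a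
    ... | _ , () , _

    inEc⊕⇒inEc₁ : InEc G R → InEc G₁ RX
    inEc⊕⇒inEc₁ ec x₀ x x′ hx hx′ = walk⊕₁ x₀ (ec (inj₁ x₀) (inj₁ x) (inj₁ x′) hx hx′) refl

    inEc⊕⇒inEc₂ : InEc G R → InEc G₂ RY
    inEc⊕⇒inEc₂ ec y₀ y y′ hy hy′ = walk⊕₂ y₀ (ec (inj₂ y₀) (inj₂ y) (inj₂ y′) hy hy′) refl

    inEc⊕⁺ : InEc G₁ RX → InEc G₂ RY → InEc G R
    inEc⊕⁺ ec₁ ec₂ (inj₁ x₀) (inj₁ x) (inj₁ x′) hx hx′ =
      walk-gmap inj₁ (λ _ _ h → h) (ec₁ x₀ x x′ hx hx′)
    inEc⊕⁺ ec₁ ec₂ (inj₂ y₀) (inj₂ y) (inj₂ y′) hy hy′ =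
      walk-gmap inj₂ (λ _ _ h → h) (ec₂ y₀ y y′ hy hy′)
    inEc⊕⁺ ec₁ ec₂ (inj₁ x₀) (inj₂ y) _ () _
    inEc⊕⁺ ec₁ ec₂ (inj₁ x₀) (inj₁ x) (inj₂ y) _ ()
    inEc⊕⁺ ec₁ ec₂ (inj₂ y₀) (inj₁ x) _ () _
    inEc⊕⁺ ec₁ ec₂ (inj₂ y₀) (inj₂ y) (inj₁ x) _ ()

    relabel-quotG₁ : relabel (λ a → ψ RX RY (inj₁ a)) (quotG G R) ≅ quotG G₁ RX
    relabel-quotG₁ = generated-≅ (relabel-generated _ (λ e → inj₁-injective (ψ-injective e)) q)
                                 (quotG-generated G₁ RX)
                                 (λ a b _ → image-ψ₁ (arc G) a b) (λ a b _ _ _ → image-ψ₁ (edge G) a b)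

    relabel-quotG₂ : relabel (λ b → ψ RX RY (inj₂ b)) (quotG G R) ≅ quotG G₂ RY
    relabel-quotG₂ = generated-≅ (relabel-generated _ (λ e → inj₂-injective (ψ-injective e)) q)
                                 (quotG-generated G₂ RY)
                                 (λ a b _ → image-ψ₂ (arc G) a b) (λ a b _ _ _ → image-ψ₂ (edge G) a b)

    restrG-⊕ : restrG G R ≅ (restrG G₁ RX · restrG G₂ RY)
    restrG-⊕ = arcs , edges
      where
      arcs : ∀ u v → arc (restrG G R) u v ≡ arc (restrG G₁ RX · restrG G₂ RY) u v
      arcs (inj₁ x) (inj₁ x′) = refl
      arcs (inj₂ y) (inj₂ y′) = refl
      arcs (inj₁ x) (inj₂ y) = ∧-zeroʳ _
      arcs (inj₂ y) (inj₁ x) = ∧-zeroʳ _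
      edges : ∀ u v → edge (restrG G R) u v ≡ edge (restrG G₁ RX · restrG G₂ RY) u v
      edges (inj₁ x) (inj₁ x′) = refl
      edges (inj₂ y) (inj₂ y′) = refl
      edges (inj₁ x) (inj₂ y) = ∧-zeroʳ _
      edges (inj₂ y) (inj₁ x) = ∧-zeroʳ _

    ideal-quotG⇒ideal : IsIdealʳ {X / RX} {Y / RY} (relabel (ψ RX RY) (quotG G R)) → IsIdealʳ {X} {Y} G
    ideal-quotG⇒ideal ideal (inj₂ y) (inj₂ y′) _ _ = refl
    ideal-quotG⇒ideal ideal (inj₂ y) (inj₁ x) _ a =
      ideal (inj₂ (cl RY y)) (inj₁ (cl RX x)) refl
        (arc⁺ q _ _ (λ e → side-mismatch (ψ-injective e))
                (inj₂ y , inj₁ x , cl⊕-inj₂ refl , cl⊕-inj₁ refl , a))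
      where
      side-mismatch : _≡_ {A = Carrier ((X / RX) ⊎ˢ (Y / RY))} (inj₂ (cl RY y)) (inj₁ (cl RX x)) → ⊥
      side-mismatch ()

    ideal⇒ideal-quotG : IsIdealʳ {X} {Y} G → IsIdealʳ {X / RX} {Y / RY} (relabel (ψ RX RY) (quotG G R))
    ideal⇒ideal-quotG ideal (inj₂ b) (inj₂ b′) _ _ = refl
    ideal⇒ideal-quotG ideal (inj₂ b) (inj₁ a) _ h =
      let (y , x , ayx) = image-ψ₂₁ (arc G) b a (proj₂ (arc⁻ q _ _ h)) in ideal (inj₂ y) (inj₁ x) refl ayx

-- Compatibility with the product and with Δ

comapᴱ : ∀ {X Y} → (Carrier Y → Carrier X) → Equiv X → Equiv Y
comapᴱ f R = record
  { rel = λ y y′ → rel R (f y) (f y′) ; rel-refl = λ y → rel-refl R (f y)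
  ; rel-sym = rel-sym R ; rel-trans = rel-trans R }

walk-·-side : ∀ {X Y} (G : MGraph X) (H : MGraph Y) P {u v} → Walk (Adjacent (G · H) P) u v → isInj₂ u ≡ isInj₂ v
walk-·-side G H P stay = refl
walk-·-side G H P (step {x = u} {y = w} a r) = trans (same-side u w (proj₂ (proj₂ (adjacent⁻ (G · H) P a))))
                                                      (walk-·-side G H P r)
  where
  same-side : ∀ u v → joined (G · H) u v ≡ true → isInj₂ u ≡ isInj₂ v
  same-side (inj₁ _) (inj₁ _) _ = refl
  same-side (inj₂ _) (inj₂ _) _ = refl

-- A class of ∼ ∈ ℰᶜ[GH] is connected in GH, so it lies on one side.
δ-·-unsplit : ∀ {X Y} (G : MGraph X) (H : MGraph Y) (R : Equiv (X ⊎ˢ Y)) →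
              ¬ (∃ λ (RX : Equiv X) → ∃ λ (RY : Equiv Y) → SameRel R (RX ⊕ RY)) → δ R (G · H) ≈₂ nothing
δ-·-unsplit G H R unsplit with InEc? (G · H) R
... | no _ = nothing
... | yes ec = ⊥-elim (unsplit (comapᴱ inj₁ R , comapᴱ inj₂ R , split))
  where
  across : ∀ u v → isInj₂ u ≢ isInj₂ v → rel R u v ≡ false
  across u v ne = ¬-not (λ h → ne (walk-·-side G H (rel R u) (ec u u v (rel-refl R u) h)))

  split : SameRel R (comapᴱ inj₁ R ⊕ comapᴱ inj₂ R)
  split (inj₁ x) (inj₁ x′) = refl
  split (inj₂ y) (inj₂ y′) = refl
  split (inj₁ x) (inj₂ y) = across (inj₁ x) (inj₂ y) (λ ())
  split (inj₂ y) (inj₁ x) = across (inj₂ y) (inj₁ x) (λ ())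

module _ {X Y} (G : MGraph X) (H : MGraph Y) (RX : Equiv X) (RY : Equiv Y) where
  open DisjointUnion RX RY

  private
    R = RX ⊕ RY

  quotG-· : relabel (ψ RX RY) (quotG (G · H) R) ≅ (quotG G RX · quotG H RY)
  quotG-· = generated-≅ (relabel-generated (ψ RX RY) ψ-injective (quotG-generated (G · H) R))
                        (·-generated (quotG-generated G RX) (quotG-generated H RY))
                        (λ z w _ → blocks (arc (G · H)) (λ _ _ → refl) (λ _ _ → refl) z w)
                        (λ z w _ _ _ → blocks (edge (G · H)) (λ _ _ → refl) (λ _ _ → refl) z w)
    where
    blocks : ∀ (r : Carrier X ⊎ Carrier Y → Carrier X ⊎ Carrier Y → Bool) →
             (∀ x y → r (inj₁ x) (inj₂ y) ≡ false) → (∀ y x → r (inj₂ y) (inj₁ x) ≡ false) →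
             ∀ z w → Image² (cl R) r (ψ RX RY z) (ψ RX RY w) ⇔
                     (Image² (cl RX) (λ x x′ → r (inj₁ x) (inj₁ x′)) ⊕ᴿ
                      Image² (cl RY) (λ y y′ → r (inj₂ y) (inj₂ y′))) z w
    blocks r no₁₂ no₂₁ (inj₁ a) (inj₁ b) = image-ψ₁ r a b
    blocks r no₁₂ no₂₁ (inj₂ a) (inj₂ b) = image-ψ₂ r a b
    blocks r no₁₂ no₂₁ (inj₁ a) (inj₂ b) =
      mk⇔ (λ i → let (x , y , h) = image-ψ₁₂ r a b i in false⇒¬true (no₁₂ x y) h) λ ()
    blocks r no₁₂ no₂₁ (inj₂ a) (inj₁ b) =
      mk⇔ (λ i → let (y , x , h) = image-ψ₂₁ r a b i in false⇒¬true (no₂₁ y x) h) λ ()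

  δ-· : map (λ { (A , B) → relabel (ψ RX RY) A , B }) (δ R (G · H)) ≈₂ m⊗m∘c (δ RX G) (δ RY H)
  δ-· with InEc? (G · H) R | InEc? G RX | InEc? H RY
  ... | yes _ | yes _ | yes _ = just (quotG-· , restrG-⊕ (G · H))
  ... | yes ec | no ¬ecX | _ = ⊥-elim (¬ecX (inEc⊕⇒inEc₁ (G · H) ec))
  ... | yes ec | yes _ | no ¬ecY = ⊥-elim (¬ecY (inEc⊕⇒inEc₂ (G · H) ec))
  ... | no ¬ec | yes ecX | yes ecY = ⊥-elim (¬ec (inEc⊕⁺ (G · H) ecX ecY))
  ... | no _ | no _ | _ = nothing
  ... | no _ | yes _ | no _ = nothing

module _ {X Y} (RX : Equiv X) (RY : Equiv Y) (G : MGraph (X ⊎ˢ Y)) where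
  open DisjointUnion RX RY

  private
    R = RX ⊕ RY
    G₁ = relabel {X ⊎ˢ Y} {X} inj₁ G
    G₂ = relabel {X ⊎ˢ Y} {Y} inj₂ G

  δ-Δ : ((λ A → Δ {X / RX} {Y / RY} (relabel (ψ RX RY) A)) ⊗Id) (δ R G) ≈₃ m₁₃₂₄ (δ⊗δ RX RY (Δ G))
  δ-Δ = by-cases (InEc? G R) (IsIdealʳ? {X} {Y} G)
    where
    Δψ : MGraph ((X ⊎ˢ Y) / R) → Maybe (MGraph (X / RX) × MGraph (Y / RY))
    Δψ A = Δ {X / RX} {Y / RY} (relabel (ψ RX RY) A)

    by-cases : Dec (InEc G R) → Dec (IsIdealʳ {X} {Y} G) →
               (Δψ ⊗Id) (δ R G) ≈₃ m₁₃₂₄ (δ⊗δ RX RY (Δ G))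
    by-cases (yes ec) (yes ideal) =
      MaybeRel-subst (⊗Id-just Δψ (δ-inEc ec) (Δ-ideal (ideal⇒ideal-quotG G ideal)))
        (cong m₁₃₂₄ (trans (cong (δ⊗δ RX RY) (Δ-ideal ideal))
                           (δ⊗δ-just RX RY (δ-inEc (inEc⊕⇒inEc₁ G ec)) (δ-inEc (inEc⊕⇒inEc₂ G ec)))))
        (just (relabel-quotG₁ G , relabel-quotG₂ G , restrG-⊕ G))
    by-cases (yes ec) (no ¬ideal) =
      MaybeRel-subst (⊗Id-nothing Δψ (δ-inEc ec) (Δ-¬ideal (λ idealQ → ¬ideal (ideal-quotG⇒ideal G idealQ))))
                     (cong (λ m → m₁₃₂₄ (δ⊗δ RX RY m)) (Δ-¬ideal ¬ideal)) nothing
    by-cases (no ¬ec) (yes ideal) =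
      MaybeRel-subst (cong (Δψ ⊗Id) (δ-¬inEc ¬ec))
                     (cong m₁₃₂₄ (trans (cong (δ⊗δ RX RY) (Δ-ideal ideal))
                                        (δ⊗δ-vanishes (InEc? G₁ RX) (InEc? G₂ RY))))
                     nothing
      where
      δ⊗δ-vanishes : Dec (InEc G₁ RX) → Dec (InEc G₂ RY) → δ⊗δ RX RY (just (G₁ , G₂)) ≡ nothing
      δ⊗δ-vanishes (yes ecX) (yes ecY) = ⊥-elim (¬ec (inEc⊕⁺ G ecX ecY))
      δ⊗δ-vanishes (no ¬ecX) _ = δ⊗δ-nothingˡ RX RY (δ-¬inEc ¬ecX)
      δ⊗δ-vanishes (yes ecX) (no ¬ecY) = δ⊗δ-nothingʳ RX RY (δ-inEc ecX) (δ-¬inEc ¬ecY)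
    by-cases (no ¬ec) (no ¬ideal) =
      MaybeRel-subst (cong (Δψ ⊗Id) (δ-¬inEc ¬ec))
                     (cong (λ m → m₁₃₂₄ (δ⊗δ RX RY m)) (Δ-¬ideal ¬ideal)) nothing

proposition1p6 :
  ∀ {c ℓ : Level} (K : CommutativeRing c ℓ) →
  -- (i) coassociativity
  (∀ (X : FinSet) (R R' : Equiv X) → Finer R R' →
     ∀ (G : MGraph X) → IsMixedGraph G →
     map (λ { (A , B , C) → relabel (φ R R') A , B , C }) ((δ (R' ⧸ R) ⊗Id) (δ R G))
       ≈₃ (Id⊗ δ R) (δ R' G))
  ×
  -- (ii) counit
  (∀ (X : FinSet) (G : MGraph X) → IsMixedGraph G →
     (∀ (H : MGraph X) → IsMixedGraph H →
        CommutativeRing._≈_ K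
          (Coeff.∑ K (Equivs X) (λ R → Coeff.coeff K (εδ⊗Id∘δ R G) H))
          (Coeff.coeff K (just G) H))
     ×
     (∀ (R : Equiv X) →
        (IsEqualityRel R → map (relabel (cl R)) (Id⊗εδ∘δ R G) ≈₁ just G)
        × (¬ IsEqualityRel R → Id⊗εδ∘δ R G ≈₁ nothing)))
  ×
  -- (iii) compatibility with the product
  (∀ (X Y : FinSet) (G : MGraph X) (H : MGraph Y) → IsMixedGraph G → IsMixedGraph H →
     (∀ (R : Equiv (X ⊎ˢ Y)) →
        ¬ (∃ λ (RX : Equiv X) → ∃ λ (RY : Equiv Y) → SameRel R (RX ⊕ RY)) →
        δ R (G · H) ≈₂ nothing)
     ×
     (∀ (RX : Equiv X) (RY : Equiv Y) →
        map (λ { (A , B) → relabel (ψ RX RY) A , B }) (δ (RX ⊕ RY) (G · H))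
          ≈₂ m⊗m∘c (δ RX G) (δ RY H)))
  ×
  -- (iv) compatibility with Δ
  (∀ (X Y : FinSet) (RX : Equiv X) (RY : Equiv Y) (G : MGraph (X ⊎ˢ Y)) → IsMixedGraph G →
     ((λ A → Δ {X / RX} {Y / RY} (relabel (ψ RX RY) A)) ⊗Id) (δ (RX ⊕ RY) G)
       ≈₃ m₁₃₂₄ (δ⊗δ RX RY (Δ G)))
proposition1p6 K =
  (λ X R R′ R⊆R′ G _ → Coassociativity.δ-coassoc G R R′ R⊆R′) ,
  (λ X G mg → (λ H _ → δ-counitˡ K G mg H) ,
              (λ R → (λ eq → δ-counitʳ-equality G R eq mg) , δ-counitʳ-nonequality G R)) ,
  (λ X Y G H _ _ → δ-·-unsplit G H , δ-· G H) ,
  (λ X Y RX RY G _ → δ-Δ RX RY G)
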